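{- For any positive integers $\alpha,\beta,m,n,r$, we have $$\frac{2}{\operatorname{lcm}(n,n+1,\ldots,n+2\beta+1)}\sum_{k=1}^{n}(k)_{\beta}^r\,(k+\beta+1)_{\beta}^r\,(k+\beta)\prod_{i=0}^{2\beta-1}w_{k+i}^{(\alpha)}(x)^m\in\mathbb{Z}[x].$$
   Context: $\operatorname{lcm}$ denotes the least common multiple. $(y)_0=1$ and $(y)_N=y(y+1)\cdots(y+N-1)$ for $N\ge1$ is the rising factorial, and $(y)_N^r$ is its $r$-th power. For positive integers $k,\alpha$, $$w_k^{(\alpha)}(x)=\sum_{j=1}^{k}w(k,j)^{\alpha}x^{j-1},\qquad w(k,j)=\frac1j\binom{k-1}{j-1}\binom{k+j}{j-1}=\binom{k-1}{j-1}\binom{k+j}{j}-\binom{k}{j}\binom{k+j}{j-1}\in\mathbb{Z}.$$ -}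

module Defs where

open import Algebra.Bundles using (RawSemiring)
import Algebra.Definitions.RawSemiring as RawSemiringDefinitions
open import Data.Fin.Base using (toℕ)
open import Data.Integer.Base using (+_)
open import Data.List.Base using (List; []; _∷_; map; applyUpTo)
open import Data.List.Relation.Unary.All using (All)
open import Data.Nat.Base using (ℕ; zero; suc; _+_; _*_; _∸_; NonZero; ≢-nonZero; ≢-nonZero⁻¹)
open import Data.Nat.Combinatorics using (_C_)
open import Data.Nat.Divisibility using (_∣_; 0∣⇒≡0; m∣m*n; n∣m*n)
open import Data.Nat.LCM using (lcm; lcm-least)
open import Data.Nat.Properties using (m*n≢0)
open import Data.Product.Base using (∃)
open import Data.Rational.Base using (ℚ; _/_; +-*-rawSemiring)
open import Data.Rational.Literals using (fromℤ)
open import Level using (Level)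
open import Relation.Binary.PropositionalEquality.Core using (_≡_; subst)

-- Univariate polynomials as coefficient lists, constant term first.
-- Trailing zeros are allowed, so equality is coefficientwise.
module Polynomial {c ℓ : Level} (R : RawSemiring c ℓ) where

  private module R = RawSemiring R

  Poly : Set c
  Poly = List R.Carrier

  coeff : Poly → ℕ → R.Carrier
  coeff []      _       = R.0#
  coeff (a ∷ p) zero    = a
  coeff (a ∷ p) (suc i) = coeff p i

  infix  4 _≋_
  infixl 6 _⊕_
  infixl 7 _⊗_
  infixr 7 _·_

  _≋_ : Poly → Poly → Set ℓ
  p ≋ q = (i : ℕ) → coeff p i R.≈ coeff q i

  _·_ : R.Carrier → Poly → Poly
  a · p = map (a R.*_) p

  _⊕_ : Poly → Poly → Poly
  []      ⊕ q       = q
  (a ∷ p) ⊕ []      = a ∷ p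
  (a ∷ p) ⊕ (b ∷ q) = (a R.+ b) ∷ (p ⊕ q)

  _⊗_ : Poly → Poly → Poly
  []      ⊗ q = []
  (a ∷ p) ⊗ q = (a · q) ⊕ (R.0# ∷ (p ⊗ q))

  rawSemiring : RawSemiring c ℓ
  rawSemiring = record
    { Carrier = Poly
    ; _≈_     = _≋_
    ; _+_     = _⊕_
    ; _*_     = _⊗_
    ; 0#      = []
    ; 1#      = R.1# ∷ []
    }

open Polynomial +-*-rawSemiring public using (_·_) renaming (Poly to ℚ[x])

private
  module ℚ[x]-Ops = RawSemiringDefinitions (Polynomial.rawSemiring +-*-rawSemiring)
  module ℚ-Ops    = RawSemiringDefinitions +-*-rawSemiring

open ℚ[x]-Ops public using () renaming (_^_ to _^ᵖ_)

-- ∑[1⋯ n ] f = f 1 + … + f n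
∑[1⋯_] : (n : ℕ) → (ℕ → ℚ[x]) → ℚ[x]
∑[1⋯ n ] f = ℚ[x]-Ops.sum {n} (λ i → f (suc (toℕ i)))

-- ∏[0⋯< n ] f = f 0 * … * f (n - 1)
∏[0⋯<_] : (n : ℕ) → (ℕ → ℚ[x]) → ℚ[x]
∏[0⋯< n ] f = ℚ[x]-Ops.product {n} (λ i → f (toℕ i))

infix 4 _∈ℤ[x]

_∈ℤ[x] : ℚ[x] → Set
p ∈ℤ[x] = All (λ a → ∃ λ z → a ≡ fromℤ z) p

fromℕ : ℕ → ℚ
fromℕ n = fromℤ (+ n)

-- rising y N = y (y + 1) ⋯ (y + N - 1)
rising : ℕ → ℕ → ℕ
rising y zero    = 1
rising y (suc N) = rising y N * (y + N)

-- lcmRange n l = lcm (n, n + 1, …, n + l)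
lcmRange : ℕ → ℕ → ℕ
lcmRange n zero    = n
lcmRange n (suc l) = lcm (lcmRange n l) (n + suc l)

private
  lcm≢0 : ∀ m n → .{{NonZero m}} → .{{NonZero n}} → NonZero (lcm m n)
  lcm≢0 m n = ≢-nonZero λ lcm≡0 →
    ≢-nonZero⁻¹ (m * n) {{m*n≢0 m n}}
      (0∣⇒≡0 (subst (_∣ m * n) lcm≡0
        (lcm-least {m} {n} (m∣m*n n) (n∣m*n m))))

lcmRange≢0 : ∀ n l → .{{NonZero n}} → NonZero (lcmRange n l)
lcmRange≢0 (suc n) zero    = _
lcmRange≢0 (suc n) (suc l) =
  lcm≢0 (lcmRange (suc n) l) (suc n + suc l) {{lcmRange≢0 (suc n) l}}

-- w (k , j) = (1 / j) binom(k - 1, j - 1) binom(k + j, j - 1), for k, j ≥ 1;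
-- its integrality is not built in.
w : (k j : ℕ) → .{{NonZero j}} → ℚ
w k j = + (((k ∸ 1) C (j ∸ 1)) * ((k + j) C (j ∸ 1))) / j

-- The coefficient of x^i is w (k , i + 1)^α, for 0 ≤ i < k.
wPoly : (α k : ℕ) → ℚ[x]
wPoly α k = applyUpTo (λ i → w k (suc i) ℚ-Ops.^ α) k

{-# OPTIONS --safe #-}

-- It suffices that p^s divides twice the sum whenever a prime power p^s divides one of
-- n, …, n + 2β + 1.  Extend w(k, j) to k ∈ ℤ by the symmetry k ↦ -1 - k.  The summand F then
-- satisfies F(-2β - k) = -F(k), and q ∣ F(k) as soon as q divides one of k, …, k + 2β.  Hence
-- modulo p^s the range of summation may be shifted, and twice the sum becomes the difference
-- of the sums of F over [0, M) and [-M, 0), where p^s ∣ M.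
--
-- These two ranges are exchanged by the commuting involutions τ_r : p^r u + b ↦ p^r (-1 - u) + b.
-- The functions f for which the composite of the operators 1 - τ_r, r ∈ S, maps f into the
-- multiples of p^|S| (for all S) form a ring, on which the difference above is a multiple of
-- p^s.  The products C(k, c) C(-1 - k, c) lie in this ring, by expanding binomial coefficients
-- digit by digit, and so does w(k, j) on every residue class modulo p^r on which p^r divides
-- neither k nor k + 1.  On the other classes the factors k, …, k + 2β of the summand supply
-- the missing power of p.

module Submission where

open import Defs

-- The obstacle is the denominator j of w(k, j), which can contain any power of p. It is traded for
-- k + 1 by (k + 1) w(k, j) = C(k-1, j-1) C(k+j, j), and the residue class of k controls how often p
-- divides k + 1. The symmetry of w exchanges k + 1 with -k, and p never divides both, so one of the
-- two forms has a denominator prime to p. The ring of functions must therefore be closed under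
-- division by functions whose values are prime to p.
--
-- Congruences modulo p for each reflection separately would not suffice. Every digit summed over
-- has to yield a further factor p, so the quotient left by one reflection must again behave well
-- under the next; hence composites of the 1 - τ_r.
--
-- The 2 comes from the oddness of F: it turns the difference of the two sums into a sum of two sums
-- of F that agree modulo p^s.

-- Finite folds in a commutative monoid, shared by sums, products and products of series.

module Folds where

  open import Algebra.Bundles using (CommutativeMonoid)
  open import Data.Nat.Base as ℕ using (ℕ; zero; suc; z<s; s<s)
  import Data.Nat.Properties as ℕ
  open import Level using (Level)
  open import Relation.Binary.PropositionalEquality as ≡ using (cong)

  module Fold {c ℓ : Level} (M : CommutativeMonoid c ℓ) where

    open CommutativeMonoid M
    open import Algebra.Properties.CommutativeSemigroup commutativeSemigroup
      using (interchange)
    open import Relation.Binary.Reasoning.Setoid setoid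

    fold : ℕ → (ℕ → Carrier) → Carrier
    fold zero    f = ε
    fold (suc n) f = f 0 ∙ fold n (λ i → f (suc i))

    fold-cong : ∀ n {f g} → (∀ {i} → i ℕ.< n → f i ≈ g i) → fold n f ≈ fold n g
    fold-cong zero    f≈g = refl
    fold-cong (suc n) f≈g = ∙-cong (f≈g z<s) (fold-cong n (λ i<n → f≈g (s<s i<n)))

    fold-snoc : ∀ n f → fold (suc n) f ≈ fold n f ∙ f n
    fold-snoc zero    f = trans (identityʳ (f 0)) (sym (identityˡ (f 0)))
    fold-snoc (suc n) f = begin
      f 0 ∙ fold (suc n) (λ i → f (suc i))          ≈⟨ ∙-congˡ (fold-snoc n _) ⟩
      f 0 ∙ (fold n (λ i → f (suc i)) ∙ f (suc n))  ≈⟨ assoc _ _ _ ⟨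
      fold (suc n) f ∙ f (suc n)                    ∎

    fold-rev : ∀ n f → fold n f ≈ fold n (λ i → f (n ℕ.∸ suc i))
    fold-rev zero    f = refl
    fold-rev (suc n) f = begin
      fold (suc n) f                        ≈⟨ fold-snoc n f ⟩
      fold n f ∙ f n                        ≈⟨ comm _ _ ⟩
      f n ∙ fold n f                        ≈⟨ ∙-congˡ (fold-rev n f) ⟩
      f n ∙ fold n (λ i → f (n ℕ.∸ suc i))  ∎

    fold-∙ : ∀ n f g → fold n (λ i → f i ∙ g i) ≈ fold n f ∙ fold n g
    fold-∙ zero    f g = sym (identityˡ ε)
    fold-∙ (suc n) f g = trans (∙-congˡ (fold-∙ n _ _)) (interchange _ _ _ _)

    fold-+ : ∀ m n f → fold (m ℕ.+ n) f ≈ fold m f ∙ fold n (λ i → f (m ℕ.+ i))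
    fold-+ zero    n f = sym (identityˡ _)
    fold-+ (suc m) n f =
      trans (∙-congˡ (fold-+ m n _)) (sym (assoc _ _ _))

    fold-ε : ∀ n → fold n (λ _ → ε) ≈ ε
    fold-ε zero    = refl
    fold-ε (suc n) = trans (identityˡ _) (fold-ε n)

    fold-swap : ∀ m n (f : ℕ → ℕ → Carrier) →
                fold m (λ i → fold n (f i)) ≈ fold n (λ j → fold m (λ i → f i j))
    fold-swap zero    n f = sym (fold-ε n)
    fold-swap (suc m) n f = trans (∙-congˡ (fold-swap m n _)) (sym (fold-∙ n _ _))

    fold-* : ∀ m n f → fold (m ℕ.* n) f ≈ fold m (λ i → fold n (λ j → f (i ℕ.* n ℕ.+ j)))
    fold-* zero    n f = refl
    fold-* (suc m) n f = begin
      fold (n ℕ.+ m ℕ.* n) f                              ≈⟨ fold-+ n (m ℕ.* n) f ⟩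
      fold n f ∙ fold (m ℕ.* n) (λ i → f (n ℕ.+ i))       ≈⟨ ∙-congˡ (fold-* m n _) ⟩
      fold n f ∙ fold m (λ i → fold n (λ j → f (n ℕ.+ (i ℕ.* n ℕ.+ j))))
        ≈⟨ ∙-congˡ (fold-cong m (λ {i} _ → fold-cong n (λ {j} _ →
             reflexive (cong f (≡.sym (ℕ.+-assoc n (i ℕ.* n) j)))))) ⟩
      fold (suc m) (λ i → fold n (λ j → f (i ℕ.* n ℕ.+ j))) ∎

-- Reflections of the higher digits, and divisibility of sums over blocks of length p^s.

module Reflections where

  open import Data.Integer.Base as ℤ hiding (suc; pred; ∣_∣)
  open import Data.Integer.Divisibility.Signed
  open import Data.Integer.Properties
  open import Data.Integer.Tactic.RingSolver using (solve-∀)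
  open import Data.Nat.Base as ℕ using (ℕ; zero; suc; z<s; s<s)
  import Data.Nat.Divisibility as ℕ
  import Data.Nat.Properties as ℕ
  open import Data.Nat.Primality using (Prime; euclidsLemma; prime⇒nonZero; prime⇒nonTrivial)
  open import Data.Sum.Base using (_⊎_; inj₁; inj₂; [_,_]′)
  open import Data.Unit.Base using (⊤; tt)
  open import Relation.Binary.PropositionalEquality
  open import Relation.Nullary using (¬_; yes; no; contradiction)
  open Folds

  open Fold +-0-commutativeMonoid public using () renaming
    ( fold to ∑ ; fold-cong to ∑-cong ; fold-snoc to ∑-snoc ; fold-rev to ∑-rev
    ; fold-∙ to ∑-+ ; fold-+ to ∑-split ; fold-* to ∑-* ; fold-swap to ∑-swap )

  ∑-∣ : ∀ {d} n {f} → (∀ {i} → i ℕ.< n → d ∣ f i) → d ∣ ∑ n f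
  ∑-∣ zero    d∣f = divides 0ℤ refl
  ∑-∣ (suc n) d∣f = ∣m∣n⇒∣m+n (d∣f z<s) (∑-∣ n (λ i<n → d∣f (s<s i<n)))

  ∑-scale : ∀ c n f → ∑ n (λ i → c * f i) ≡ c * ∑ n f
  ∑-scale c zero    f = sym (*-zeroʳ c)
  ∑-scale c (suc n) f =
    trans (cong (_+_ (c * f 0)) (∑-scale c n _)) (sym (*-distribˡ-+ c (f 0) _))

  ∑-neg : ∀ n f → ∑ n (λ i → - f i) ≡ - ∑ n f
  ∑-neg zero    f = refl
  ∑-neg (suc n) f =
    trans (cong (_+_ (- f 0)) (∑-neg n _)) (sym (neg-distrib-+ (f 0) _))

  -- On base-p expansions this complements every digit, hence its compatibility with splitting off
  -- the lowest digit in `ν-digit`.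
  ν : ℤ → ℤ
  ν a = -1ℤ + - a

  ν-involutive : ∀ a → ν (ν a) ≡ a
  ν-involutive = lemma
    where
    lemma : ∀ a → -1ℤ + - (-1ℤ + - a) ≡ a
    lemma = solve-∀

  -- `cancel` stands in for working over the integers localised at p: denominators prime to p are
  -- cleared without leaving ℤ. `refl-ν` is there because the difference quotient of a product
  -- involves `f (ν a)`.
  record Closed (p : ℕ) (P : (ℤ → ℤ) → Set) : Set where
    field
      ext    : ∀ {f g} → (∀ a → f a ≡ g a) → P f → P g
      add    : ∀ {f g} → P f → P g → P (λ a → f a + g a)
      mul    : ∀ {f g} → P f → P g → P (λ a → f a * g a)
      con    : ∀ c → P (λ _ → c)
      refl-ν : ∀ {f} → P f → P (λ a → f (ν a))
      cancel : ∀ {h f} → (∀ a → ¬ + p ∣ h a) → P h → P (λ a → h a * f a) → P f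

    negate : ∀ {f} → P f → P (λ a → - f a)
    negate {f} Pf = ext (λ a → -1*i≡-i (f a)) (mul (con -1ℤ) Pf)

    sub : ∀ {f g} → P f → P g → P (λ a → f a - g a)
    sub Pf Pg = add Pf (negate Pg)

  -- `δ` is the quotient (f - f ∘ ν) / p. That it lies in `P` again is what allows further powers of
  -- p to be extracted from it.
  record FineBy (p : ℕ) (P : (ℤ → ℤ) → Set) (f : ℤ → ℤ) : Set where
    field
      good   : P f
      δ      : ℤ → ℤ
      δ-eq   : ∀ a → f a ≡ f (ν a) + + p * δ a
      δ-good : P δ

  dig : ℕ → ℕ → (ℤ → ℤ) → ℤ → ℤ
  dig p b f a = f (+ p * a + + b)

  -- With the reflections τ_r that replace the part u of p^r u + b by ν u, Good p s f says that
  -- the composite of (1 - τ_r) over r ∈ S maps f into multiples of p^|S|, for all S ⊆ {1,…,s}.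
  Good : ℕ → ℕ → (ℤ → ℤ) → Set
  Good p zero    f = ⊤
  Good p (suc s) f = ∀ {b} → b ℕ.< p → FineBy p (Good p s) (dig p b f)

  -- Adds τ_0 = `ν` to the reflections that `Good` takes into account, so that S ranges over the
  -- subsets of {0,...,s}.
  Fine : ℕ → ℕ → (ℤ → ℤ) → Set
  Fine p s = FineBy p (Good p s)

  -- The sum of f over the p^s integers from p^s u on (`σ-block`). The lowest digit is split off
  -- first, so that the recursion matches that of `Good`.
  σ : ℕ → ℕ → (ℤ → ℤ) → ℤ → ℤ
  σ p zero    f u = f u
  σ p (suc s) f u = ∑ p (λ b → σ p s (dig p b f) u)

  σ-cong : ∀ p s {f g} → (∀ a → f a ≡ g a) → ∀ u → σ p s f u ≡ σ p s g u
  σ-cong p zero    f≡g u = f≡g u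
  σ-cong p (suc s) f≡g u = ∑-cong p (λ {b} _ → σ-cong p s (λ a → f≡g (+ p * a + + b)) u)

  σ-+ : ∀ p s f g u → σ p s (λ a → f a + g a) u ≡ σ p s f u + σ p s g u
  σ-+ p zero    f g u = refl
  σ-+ p (suc s) f g u =
    trans (∑-cong p (λ {b} _ → σ-+ p s (dig p b f) (dig p b g) u)) (∑-+ p _ _)

  σ-scale : ∀ p s c f u → σ p s (λ a → c * f a) u ≡ c * σ p s f u
  σ-scale p zero    c f u = refl
  σ-scale p (suc s) c f u =
    trans (∑-cong p (λ {b} _ → σ-scale p s c (dig p b f) u)) (∑-scale c p _)

  ∸-complement : ∀ {n b} → b ℕ.< n → b ℕ.+ (n ℕ.∸ suc b) ℕ.+ 1 ≡ n
  ∸-complement {n} {b} b<n = trans (ℕ.+-comm _ 1) (ℕ.m+[n∸m]≡n b<n)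

  ν-digit : ∀ p b b′ → b ℕ.+ b′ ℕ.+ 1 ≡ p → ∀ a → ν (+ p * a + + b) ≡ + p * ν a + + b′
  ν-digit _ b b′ refl a rewrite pos-+ (b ℕ.+ b′) 1 | pos-+ b b′ = lemma (+ b) (+ b′) a
    where
    lemma : ∀ x y a → -1ℤ + - ((x + y + 1ℤ) * a + x) ≡ (x + y + 1ℤ) * (-1ℤ + - a) + y
    lemma = solve-∀

  ∸-suc-< : ∀ {n b} → b ℕ.< n → n ℕ.∸ suc b ℕ.< n
  ∸-suc-< {suc n} {b} _ = ℕ.s≤s (ℕ.m∸n≤m n b)

  σ-ν : ∀ p s f u → σ p s (λ a → f (ν a)) u ≡ σ p s f (ν u)
  σ-ν p zero    f u = refl
  σ-ν p (suc s) f u = begin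
    ∑ p (λ b → σ p s (λ a → f (ν (+ p * a + + b))) u)
      ≡⟨ ∑-cong p (λ {b} b<p → σ-cong p s
           (λ a → cong f (ν-digit p b (p ℕ.∸ suc b) (∸-complement b<p) a)) u) ⟩
    ∑ p (λ b → σ p s (λ a → dig p (p ℕ.∸ suc b) f (ν a)) u)
      ≡⟨ ∑-cong p (λ {b} _ → σ-ν p s (dig p (p ℕ.∸ suc b) f) u) ⟩
    ∑ p (λ b → σ p s (dig p (p ℕ.∸ suc b) f) (ν u))
      ≡⟨ ∑-rev p (λ b → σ p s (dig p b f) (ν u)) ⟨
    ∑ p (λ b → σ p s (dig p b f) (ν u)) ∎
    where open ≡-Reasoning

  pos-nonZero : ∀ n → .{{ℕ.NonZero n}} → NonZero (+ n)
  pos-nonZero (suc n) = _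

  module _ {p : ℕ} (p-prime : Prime p) where

    private instance
      p≢0 : ℕ.NonZero p
      p≢0 = prime⇒nonZero p-prime

      +p≢0 : NonZero (+ p)
      +p≢0 = pos-nonZero p

    euclid : ∀ x y → + p ∣ x * y → + p ∣ x ⊎ + p ∣ y
    euclid x y p∣xy with euclidsLemma ℤ.∣ x ∣ ℤ.∣ y ∣ p-prime
                           (subst (p ℕ.∣_) (abs-* x y) (∣⇒∣ᵤ p∣xy))
    ... | inj₁ p∣x = inj₁ (∣ᵤ⇒∣ p∣x)
    ... | inj₂ p∣y = inj₂ (∣ᵤ⇒∣ p∣y)

    prime-cancel : ∀ x y → ¬ + p ∣ x → + p ∣ x * y → + p ∣ y
    prime-cancel x y p∤x p∣xy = [ (λ p∣x → contradiction p∣x p∤x) , (λ p∣y → p∣y) ]′ (euclid x y p∣xy)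

    ∤-* : ∀ {x y} → ¬ + p ∣ x → ¬ + p ∣ y → ¬ + p ∣ x * y
    ∤-* {x} {y} p∤x p∤y p∣xy = p∤y (prime-cancel x y p∤x p∣xy)

    prime-power-cancel : ∀ s x y → ¬ + p ∣ x → + (p ℕ.^ s) ∣ x * y → + (p ℕ.^ s) ∣ y
    prime-power-cancel zero    x y p∤x _ = divides y (sym (*-identityʳ y))
    prime-power-cancel (suc s) x y p∤x (divides q xy≡) =
      subst₂ _∣_ (sym (pos-* p (p ℕ.^ s))) (trans (*-comm (+ p) z) (sym y≡zp))
        (*-monoʳ-∣ (+ p) (prime-power-cancel s x z p∤x (divides q xz≡)))
      where
      open ≡-Reasoning
      p∣y : + p ∣ y
      p∣y = prime-cancel x y p∤x (divides (q * + (p ℕ.^ s)) (begin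
        x * y                   ≡⟨ xy≡ ⟩
        q * + (p ℕ.^ suc s)     ≡⟨ cong (q *_) (trans (pos-* p (p ℕ.^ s)) (*-comm (+ p) _)) ⟩
        q * (+ (p ℕ.^ s) * + p) ≡⟨ *-assoc q _ _ ⟨
        q * + (p ℕ.^ s) * + p   ∎))
      z : ℤ
      z = quotient p∣y
      y≡zp : y ≡ z * + p
      y≡zp = _∣_.equality p∣y
      xz≡ : x * z ≡ q * + (p ℕ.^ s)
      xz≡ = *-cancelʳ-≡ _ _ (+ p) (begin
        x * z * + p             ≡⟨ *-assoc x z (+ p) ⟩
        x * (z * + p)           ≡⟨ cong (x *_) y≡zp ⟨
        x * y                   ≡⟨ xy≡ ⟩
        q * + (p ℕ.^ suc s)     ≡⟨ cong (q *_) (trans (pos-* p (p ℕ.^ s)) (*-comm (+ p) _)) ⟩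
        q * (+ (p ℕ.^ s) * + p) ≡⟨ *-assoc q _ _ ⟨
        q * + (p ℕ.^ s) * + p   ∎)

    private
      pos-^-suc : ∀ s → + (p ℕ.^ suc s) ≡ + p * + (p ℕ.^ s)
      pos-^-suc s = pos-* p (p ℕ.^ s)

    module _ {P : (ℤ → ℤ) → Set} (P-closed : Closed p P) where

      open Closed P-closed
      open FineBy

      ν-invariant⇒fine : ∀ {f} → (∀ a → f a ≡ f (ν a)) → P f → FineBy p P f
      ν-invariant⇒fine {f} inv Pf = record
        { good = Pf ; δ = λ _ → 0ℤ ; δ-good = con 0ℤ
        ; δ-eq = λ a → trans (inv a) (sym (trans (cong (_+_ (f (ν a))) (*-zeroʳ (+ p))) (+-identityʳ (f (ν a))))) }

      -- The factor p already pays for the reflection, so no congruence between f and f ∘ ν is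
      -- required.
      p*-fine : ∀ {f} → P f → FineBy p P (λ a → + p * f a)
      p*-fine {f} Pf = record
        { good = mul (con (+ p)) Pf ; δ = λ a → f a - f (ν a) ; δ-good = sub Pf (refl-ν Pf)
        ; δ-eq = λ a → eq (+ p) (f a) (f (ν a)) }
        where
        eq : ∀ p x y → p * x ≡ p * y + p * (x - y)
        eq = solve-∀

      fineBy-closed : Closed p (FineBy p P)
      fineBy-closed = record
        { ext = λ {f} {g} f≡g F → record
            { good = ext f≡g (good F) ; δ = δ F ; δ-good = δ-good F
            ; δ-eq = λ a → trans (sym (f≡g a))
                      (trans (δ-eq F a) (cong (_+ + p * δ F a) (f≡g (ν a)))) }
        ; add = λ {f} {g} F G → record
            { good = add (good F) (good G) ; δ = λ a → δ F a + δ G a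
            ; δ-good = add (δ-good F) (δ-good G)
            ; δ-eq = λ a → trans (cong₂ _+_ (δ-eq F a) (δ-eq G a))
                      (add-eq (+ p) (f (ν a)) (g (ν a)) (δ F a) (δ G a)) }
        ; mul = λ {f} {g} F G → record
            { good = mul (good F) (good G)
            ; δ = λ a → f (ν a) * δ G a + δ F a * g a
            ; δ-good = add (mul (refl-ν (good F)) (δ-good G)) (mul (δ-good F) (good G))
            ; δ-eq = λ a → mul-eq (+ p) (f (ν a)) (g (ν a)) (δ F a) (δ G a) (δ-eq F a) (δ-eq G a) }
        ; con = λ c → ν-invariant⇒fine (λ _ → refl) (con c)
        ; refl-ν = λ {f} F → record
            { good = refl-ν (good F) ; δ = λ a → - δ F a ; δ-good = negate (δ-good F)
            ; δ-eq = λ a → refl-eq (+ p) (δ-eq F a) (cong f (ν-involutive a)) }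
        -- Comparing the reflections of h and of h f gives h (f - f ∘ ν) = p (δ of h f - δ of h
        -- times f ∘ ν). As p does not divide h, it divides f - f ∘ ν; h times the quotient lies in
        -- `P`, and a second cancellation inside `P` puts the quotient there.
        ; cancel = λ {h} {f} p∤h H HF →
            let Pf = cancel p∤h (good H) (good HF)
                δ-mul : ∀ a → h a * (f a - f (ν a)) ≡ (δ HF a - δ H a * f (ν a)) * + p
                δ-mul a = cancel-eq (+ p) (h (ν a)) (f a) (f (ν a)) (δ H a) (δ HF a) (δ-eq H a) (δ-eq HF a)
                p∣ : ∀ a → + p ∣ f a - f (ν a)
                p∣ a = prime-cancel (h a) (f a - f (ν a)) (p∤h a) (divides (δ HF a - δ H a * f (ν a)) (δ-mul a))
                hq : ∀ a → h a * quotient (p∣ a) ≡ δ HF a - δ H a * f (ν a)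
                hq a = *-cancelʳ-≡ (h a * quotient (p∣ a)) (δ HF a - δ H a * f (ν a)) (+ p) (trans (*-assoc (h a) (quotient (p∣ a)) (+ p))
                         (trans (cong (h a *_) (sym (_∣_.equality (p∣ a)))) (δ-mul a)))
            in record
            { good = Pf ; δ = λ a → quotient (p∣ a)
            ; δ-good = cancel p∤h (good H) (ext (λ a → sym (hq a))
                         (sub (δ-good HF) (mul (δ-good H) (refl-ν Pf))))
            ; δ-eq = λ a → quot-eq (f a) (f (ν a)) (quotient (p∣ a)) (_∣_.equality (p∣ a)) } }
        where
        add-eq : ∀ p x y u v → x + p * u + (y + p * v) ≡ x + y + p * (u + v)
        add-eq = solve-∀
        mul-eq : ∀ p x′ y′ u v {x y} → x ≡ x′ + p * u → y ≡ y′ + p * v →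
                 x * y ≡ x′ * y′ + p * (x′ * v + u * y)
        mul-eq p x′ y′ u v refl refl = lem p x′ y′ u v
          where
          lem : ∀ p x′ y′ u v → (x′ + p * u) * (y′ + p * v) ≡
                x′ * y′ + p * (x′ * v + u * (y′ + p * v))
          lem = solve-∀
        refl-eq : ∀ p {x y z u} → x ≡ y + p * u → z ≡ x → y ≡ z + p * - u
        refl-eq p {y = y} {u = u} refl refl = lem p y u
          where
          lem : ∀ p y u → y ≡ y + p * u + p * - u
          lem = solve-∀
        cancel-eq : ∀ p h′ f f′ u v {h} → h ≡ h′ + p * u → h * f ≡ h′ * f′ + p * v →
                    h * (f - f′) ≡ (v - u * f′) * p
        cancel-eq p h′ f f′ u v {h} h≡ hf≡ = begin
          h * (f - f′)                               ≡⟨ l₁ h f f′ ⟩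
          h * f - h * f′                             ≡⟨ cong₂ (λ x y → x - y * f′) hf≡ h≡ ⟩
          h′ * f′ + p * v - (h′ + p * u) * f′        ≡⟨ l₂ p h′ f′ u v ⟩
          (v - u * f′) * p                           ∎
          where
          open ≡-Reasoning
          l₁ : ∀ h f f′ → h * (f - f′) ≡ h * f - h * f′
          l₁ = solve-∀
          l₂ : ∀ p h′ f′ u v → h′ * f′ + p * v - (h′ + p * u) * f′ ≡ (v - u * f′) * p
          l₂ = solve-∀
        quot-eq : ∀ x y q → x - y ≡ q * + p → x ≡ y + + p * q
        quot-eq x y q eq = trans (l x y) (cong (_+_ y) (trans eq (*-comm q (+ p))))
          where
          l : ∀ x y → x ≡ y + (x - y)
          l = solve-∀

    good-closed : ∀ s → Closed p (Good p s)
    good-closed zero = record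
      { ext = λ _ _ → tt ; add = λ _ _ → tt ; mul = λ _ _ → tt ; con = λ _ → tt
      ; refl-ν = λ _ → tt ; cancel = λ _ _ _ → tt }
    good-closed (suc s) = record
      { ext    = λ f≡g F b<p → ext (λ a → f≡g _) (F b<p)
      ; add    = λ F G b<p → add (F b<p) (G b<p)
      ; mul    = λ F G b<p → mul (F b<p) (G b<p)
      ; con    = λ c b<p → con c
      ; refl-ν = λ {f} F {b} b<p →
          ext (λ a → cong f (sym (ν-digit p b (p ℕ.∸ suc b) (∸-complement b<p) a)))
            (refl-ν (F (∸-suc-< b<p)))
      ; cancel = λ p∤h H HF b<p → cancel (λ a → p∤h _) (H b<p) (HF b<p) }
      where open Closed (fineBy-closed (good-closed s))

    fine-closed : ∀ s → Closed p (Fine p s)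
    fine-closed s = fineBy-closed (good-closed s)

    -- Proved together with `good-id`: on each digit class the identity is p a + b, whose variable
    -- part has a factor p. The identity itself is not fine, since a - ν a = 2a + 1.
    affine-fine : ∀ s c → Fine p s (λ a → + p * a + c)
    good-id : ∀ s → Good p s (λ a → a)

    affine-fine s c = Closed.add (fine-closed s) (p*-fine (good-closed s) (good-id s))
                        (Closed.con (fine-closed s) c)
    good-id zero    = tt
    good-id (suc s) {b} _ = affine-fine s (+ b)

    twice-paired-sum : ∀ P (X : ℕ → ℤ) → (∀ {b} → b ℕ.< p → P ∣ X b + X (p ℕ.∸ suc b)) →
                     P ∣ + 2 * ∑ p X
    twice-paired-sum P X P∣ = subst (P ∣_) eq (∑-∣ p P∣)
      where
      eq : ∑ p (λ b → X b + X (p ℕ.∸ suc b)) ≡ + 2 * ∑ p X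
      eq = trans (∑-+ p X _) (trans (cong (_+_ (∑ p X)) (sym (∑-rev p X))) (double (∑ p X)))
        where
        double : ∀ x → x + x ≡ + 2 * x
        double = solve-∀

    -- Adding the sum to its reversal doubles it, which is harmless for odd p. For p = 2 the two
    -- terms already form a single pair, so no power of 2 is lost either.
    paired-sum : ∀ s (X : ℕ → ℤ) →
                      (∀ {b} → b ℕ.< p → + (p ℕ.^ s) ∣ X b + X (p ℕ.∸ suc b)) →
                      + (p ℕ.^ s) ∣ ∑ p X
    paired-sum s X P∣ with p ℕ.≟ 2
    ... | yes refl = subst (+ (p ℕ.^ s) ∣_) (cong (_+_ (X 0)) (sym (+-identityʳ (X 1)))) (P∣ {0} z<s)
    ... | no  p≢2  = prime-power-cancel s (+ 2) (∑ p X) p∤2 (twice-paired-sum (+ (p ℕ.^ s)) X P∣)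
      where
      p∤2 : ¬ + p ∣ + 2
      p∤2 p∣2 = p≢2 (ℕ.≤-antisym (ℕ.∣⇒≤ (∣⇒∣ᵤ p∣2)) (ℕ.nonTrivial⇒n>1 p {{prime⇒nonTrivial p-prime}}))

    -- f - f ∘ ν changes sign under ν. This oddness is the invariant of the induction in
    -- `antisymmetric-sum`.
    δ-odd : ∀ {P f} (F : FineBy p P f) a → FineBy.δ F (ν a) ≡ - FineBy.δ F a
    δ-odd {f = f} F a = *-cancelˡ-≡ (+ p) _ _ (lem (+ p) (δ-eq a)
                  (trans (δ-eq (ν a)) (cong (λ x → f x + + p * δ (ν a)) (ν-involutive a))))
      where
      open FineBy F
      lem : ∀ p {x y u v} → x ≡ y + p * u → y ≡ x + p * v → p * v ≡ p * - u
      lem p {x} {y} {u} {v} eq₁ eq₂ = trans (l₁ (p * v) x) (trans (cong (_- x) (sym eq₂))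
          (trans (cong (λ z → y - z) eq₁) (l₂ p y u)))
        where
        l₁ : ∀ z x → z ≡ x + z - x
        l₁ = solve-∀
        l₂ : ∀ p y u → y - (y + p * u) ≡ p * - u
        l₂ = solve-∀

    -- Oddness identifies g at digit b and argument ν a with -g at the complementary digit and
    -- argument a. So the values at complementary digits add up to p times the quotient `δ` of the
    -- digit b, which is odd and good one level lower: each digit contributes one factor p.
    antisymmetric-sum : ∀ s g → Good p s g → (∀ a → g (ν a) ≡ - g a) →
                        ∀ u → + (p ℕ.^ s) ∣ σ p s g u
    antisymmetric-sum zero    g _ _   u = divides (g u) (sym (*-identityʳ (g u)))
    antisymmetric-sum (suc s) g G odd u =
      paired-sum (suc s) (λ b → σ p s (dig p b g) u) pair
      where
      open FineBy
      pair : ∀ {b} → b ℕ.< p →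
             + (p ℕ.^ suc s) ∣ σ p s (dig p b g) u + σ p s (dig p (p ℕ.∸ suc b) g) u
      pair {b} b<p =
        subst₂ _∣_ (sym (pos-^-suc s)) sum-eq
          (*-monoʳ-∣ (+ p) (antisymmetric-sum s h (δ-good (G b<p)) (δ-odd (G b<p)) u))
        where
        open ≡-Reasoning
        b′ = p ℕ.∸ suc b
        h = δ (G b<p)
        g-flip : ∀ a → dig p b g (ν a) ≡ - dig p b′ g a
        g-flip a = begin
          g (+ p * ν a + + b)     ≡⟨ cong g (ν-digit p b′ b (trans (cong (ℕ._+ 1) (ℕ.+-comm b′ b)) (∸-complement b<p)) a) ⟨
          g (ν (+ p * a + + b′))  ≡⟨ odd _ ⟩
          - g (+ p * a + + b′)    ∎
        p*h : ∀ a → dig p b g a + dig p b′ g a ≡ + p * h a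
        p*h a = begin
          dig p b g a + dig p b′ g a
            ≡⟨ cong (_+ dig p b′ g a) (trans (δ-eq (G b<p) a) (cong (_+ + p * h a) (g-flip a))) ⟩
          - dig p b′ g a + + p * h a + dig p b′ g a
            ≡⟨ lem (dig p b′ g a) (+ p * h a) ⟩
          + p * h a ∎
          where
          lem : ∀ x y → - x + y + x ≡ y
          lem = solve-∀
        sum-eq : + p * σ p s h u ≡ σ p s (dig p b g) u + σ p s (dig p b′ g) u
        sum-eq = begin
          + p * σ p s h u                                  ≡⟨ σ-scale p s (+ p) h u ⟨
          σ p s (λ a → + p * h a) u                        ≡⟨ σ-cong p s p*h u ⟨
          σ p s (λ a → dig p b g a + dig p b′ g a) u       ≡⟨ σ-+ p s _ _ u ⟩
          σ p s (dig p b g) u + σ p s (dig p b′ g) u       ∎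

    -- By `σ-ν` the difference is p times the block sum of `δ`, which is odd; `antisymmetric-sum`
    -- supplies the other s factors.
    fine-balance : ∀ s f → Fine p s f → ∀ u → + (p ℕ.^ suc s) ∣ σ p s f u - σ p s f (ν u)
    fine-balance s f F u =
      subst₂ _∣_ (sym (pos-^-suc s)) sum-eq
        (*-monoʳ-∣ (+ p) (antisymmetric-sum s (δ F) (δ-good F) (δ-odd F) u))
      where
      open FineBy
      open ≡-Reasoning
      sum-eq : + p * σ p s (δ F) u ≡ σ p s f u - σ p s f (ν u)
      sum-eq = begin
        + p * σ p s (δ F) u                       ≡⟨ σ-scale p s (+ p) (δ F) u ⟨
        σ p s (λ a → + p * δ F a) u               ≡⟨ l (σ p s (λ a → + p * δ F a) u) (σ p s f (ν u)) ⟩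
        σ p s f (ν u) + σ p s (λ a → + p * δ F a) u - σ p s f (ν u)
          ≡⟨ cong (λ x → x + σ p s (λ a → + p * δ F a) u - σ p s f (ν u)) (σ-ν p s f u) ⟨
        σ p s (λ a → f (ν a)) u + σ p s (λ a → + p * δ F a) u - σ p s f (ν u)
          ≡⟨ cong (_- σ p s f (ν u)) (trans (σ-cong p s (δ-eq F) u) (σ-+ p s _ _ u)) ⟨
        σ p s f u - σ p s f (ν u)                 ∎
        where
        l : ∀ x y → x ≡ y + x - y
        l = solve-∀

-- Binomial coefficients with integer upper argument, and the extension of w to all integers.

module Binomials where

  open import Data.Integer.Base as ℤ hiding (suc; pred; ∣_∣)
  open import Data.Integer.Properties
  open import Data.Integer.Tactic.RingSolver using (solve-∀)
  open import Data.Nat.Base as ℕ using (ℕ; zero; suc)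
  open import Data.Nat.Combinatorics using (_C_; nCk+nC[k+1]≡[n+1]C[k+1]; nC1≡n; k>n⇒nCk≡0)
  import Data.Nat.Properties as ℕ
  import Data.Nat.Tactic.RingSolver as ℕ-Solver
  open import Relation.Binary.PropositionalEquality
  open Reflections using (ν; ν-involutive)

  C-absorb : ∀ n k → suc k ℕ.* (suc n C suc k) ≡ suc n ℕ.* (n C k)
  C-absorb n       zero    = trans (ℕ.*-identityˡ (suc n C 1)) (trans (nC1≡n (suc n)) (sym (ℕ.*-identityʳ (suc n))))
  C-absorb zero    (suc k) = trans (cong (suc (suc k) ℕ.*_) (k>n⇒nCk≡0 {1} {2 ℕ.+ k} (ℕ.s≤s (ℕ.s≤s ℕ.z≤n)))) (ℕ.*-zeroʳ k)
  C-absorb (suc n) (suc k) = begin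
    suc (suc k) ℕ.* (suc (suc n) C suc (suc k))
      ≡⟨ cong (suc (suc k) ℕ.*_) (nCk+nC[k+1]≡[n+1]C[k+1] (suc n) (suc k)) ⟨
    suc (suc k) ℕ.* (A ℕ.+ B)
      ≡⟨ l₁ k A B ⟩
    A ℕ.+ (suc k ℕ.* A ℕ.+ suc (suc k) ℕ.* B)
      ≡⟨ cong (A ℕ.+_) (cong₂ ℕ._+_ (C-absorb n k) (C-absorb n (suc k))) ⟩
    A ℕ.+ (suc n ℕ.* (n C k) ℕ.+ suc n ℕ.* (n C suc k))
      ≡⟨ cong (A ℕ.+_) (ℕ.*-distribˡ-+ (suc n) (n C k) (n C suc k)) ⟨
    A ℕ.+ suc n ℕ.* (n C k ℕ.+ n C suc k)
      ≡⟨ cong (λ x → A ℕ.+ suc n ℕ.* x) (nCk+nC[k+1]≡[n+1]C[k+1] n k) ⟩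
    suc (suc n) ℕ.* A ∎
    where
    open ≡-Reasoning
    A = suc n C suc k
    B = suc n C suc (suc k)
    l₁ : ∀ k A B → suc (suc k) ℕ.* (A ℕ.+ B) ≡ A ℕ.+ (suc k ℕ.* A ℕ.+ suc (suc k) ℕ.* B)
    l₁ = ℕ-Solver.solve-∀

  infix 7.5 _choose_

  -- The negative case is upper negation, C(-n-1, x) = (-1)^x C(n+x, x).
  _choose_ : ℤ → ℕ → ℤ
  (+ n)    choose x = + (n C x)
  -[1+ n ] choose x = -1ℤ ^ x * + ((n ℕ.+ x) C x)

  choose-zero : ∀ k → k choose 0 ≡ 1ℤ
  choose-zero (+ n)    = refl
  choose-zero -[1+ n ] = refl

  pos-suc : ∀ n → + suc n ≡ 1ℤ + + n
  pos-suc n = pos-+ 1 n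

  choose-absorb : ∀ k x → + suc x * (k choose suc x) ≡ (k - + x) * (k choose x)
  choose-absorb (+ n) x = begin
    + suc x * + B                           ≡⟨ l₁ (+ suc x) (+ A) (+ B) ⟩
    + suc x * (+ A + + B) - + suc x * + A   ≡⟨ cong₂ (λ u v → u - v * + A) eq (pos-suc x) ⟩
    (1ℤ + + n) * + A - (1ℤ + + x) * + A     ≡⟨ l₂ (+ n) (+ x) (+ A) ⟩
    (+ n - + x) * + A                       ∎
    where
    open ≡-Reasoning
    A = n C x
    B = n C suc x
    eq : + suc x * (+ A + + B) ≡ (1ℤ + + n) * + A
    eq = begin
      + suc x * (+ A + + B)          ≡⟨ cong (λ u → + suc x * u) (pos-+ A B) ⟨
      + suc x * + (A ℕ.+ B)          ≡⟨ cong (λ u → + suc x * + u) (nCk+nC[k+1]≡[n+1]C[k+1] n x) ⟩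
      + suc x * + (suc n C suc x)    ≡⟨ pos-* (suc x) _ ⟨
      + (suc x ℕ.* (suc n C suc x))  ≡⟨ cong +_ (C-absorb n x) ⟩
      + (suc n ℕ.* A)                ≡⟨ pos-* (suc n) A ⟩
      + suc n * + A                  ≡⟨ cong (_* + A) (pos-suc n) ⟩
      (1ℤ + + n) * + A               ∎
    l₁ : ∀ s a b → s * b ≡ s * (a + b) - s * a
    l₁ = solve-∀
    l₂ : ∀ n x a → (1ℤ + n) * a - (1ℤ + x) * a ≡ (n - x) * a
    l₂ = solve-∀
  choose-absorb -[1+ n ] x = begin
    + suc x * (-1ℤ * s * + ((n ℕ.+ suc x) C suc x))
      ≡⟨ cong (λ u → + suc x * (-1ℤ * s * + (u C suc x))) (ℕ.+-suc n x) ⟩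
    + suc x * (-1ℤ * s * + (suc (n ℕ.+ x) C suc x))
      ≡⟨ l₁ (+ suc x) s (+ (suc (n ℕ.+ x) C suc x)) ⟩
    -1ℤ * s * (+ suc x * + (suc (n ℕ.+ x) C suc x))
      ≡⟨ cong (λ u → -1ℤ * s * u) eq ⟩
    -1ℤ * s * ((1ℤ + (+ n + + x)) * + A)
      ≡⟨ l₂ s (+ n) (+ x) (+ A) ⟩
    (- (1ℤ + + n) - + x) * (s * + A)
      ≡⟨ cong (λ u → (- u - + x) * (s * + A)) (pos-suc n) ⟨
    (-[1+ n ] - + x) * (s * + A) ∎
    where
    open ≡-Reasoning
    s = -1ℤ ^ x
    A = (n ℕ.+ x) C x
    eq : + suc x * + (suc (n ℕ.+ x) C suc x) ≡ (1ℤ + (+ n + + x)) * + A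
    eq = begin
      + suc x * + (suc (n ℕ.+ x) C suc x)    ≡⟨ pos-* (suc x) _ ⟨
      + (suc x ℕ.* (suc (n ℕ.+ x) C suc x))  ≡⟨ cong +_ (C-absorb (n ℕ.+ x) x) ⟩
      + (suc (n ℕ.+ x) ℕ.* A)                ≡⟨ pos-* (suc (n ℕ.+ x)) A ⟩
      + suc (n ℕ.+ x) * + A                  ≡⟨ cong (_* + A) (trans (pos-suc (n ℕ.+ x)) (cong (_+_ 1ℤ) (pos-+ n x))) ⟩
      (1ℤ + (+ n + + x)) * + A               ∎
    l₁ : ∀ a s c → a * (-1ℤ * s * c) ≡ -1ℤ * s * (a * c)
    l₁ = solve-∀
    l₂ : ∀ s n x a → -1ℤ * s * ((1ℤ + (n + x)) * a) ≡ (- (1ℤ + n) - x) * (s * a)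
    l₂ = solve-∀

  choose-absorb′ : ∀ k x → + suc x * (k choose suc x) ≡ k * ((k - 1ℤ) choose x)
  choose-absorb′ k zero = begin
    1ℤ * (k choose 1)            ≡⟨ choose-absorb k 0 ⟩
    (k - 0ℤ) * (k choose 0)      ≡⟨ cong₂ _*_ (+-identityʳ k) (trans (choose-zero k) (sym (choose-zero (k - 1ℤ)))) ⟩
    k * ((k - 1ℤ) choose 0)      ∎
    where open ≡-Reasoning
  choose-absorb′ k (suc x) = *-cancelˡ-≡ (+ suc x) _ _ (begin
    + suc x * (+ suc (suc x) * (k choose suc (suc x)))
      ≡⟨ cong (λ u → + suc x * u) (choose-absorb k (suc x)) ⟩
    + suc x * ((k - + suc x) * (k choose suc x))
      ≡⟨ l₁ (+ suc x) (k - + suc x) (k choose suc x) ⟩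
    (k - + suc x) * (+ suc x * (k choose suc x))
      ≡⟨ cong₂ (λ u v → (k - u) * v) (pos-suc x) (choose-absorb′ k x) ⟩
    (k - (1ℤ + + x)) * (k * ((k - 1ℤ) choose x))
      ≡⟨ l₂ k (+ x) ((k - 1ℤ) choose x) ⟩
    k * ((k - 1ℤ - + x) * ((k - 1ℤ) choose x))
      ≡⟨ cong (k *_) (choose-absorb (k - 1ℤ) x) ⟨
    k * (+ suc x * ((k - 1ℤ) choose suc x))
      ≡⟨ l₁ k (+ suc x) _ ⟩
    + suc x * (k * ((k - 1ℤ) choose suc x)) ∎)
    where
    open ≡-Reasoning
    l₁ : ∀ a b c → a * (b * c) ≡ b * (a * c)
    l₁ = solve-∀
    l₂ : ∀ k x c → (k - (1ℤ + x)) * (k * c) ≡ k * ((k - 1ℤ - x) * c)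
    l₂ = solve-∀

  -- For k ≥ 1, ω k i is (-1)^i w(k, i + 1), and it extends w to all integers k so that the
  -- symmetry k ↦ -1 - k is manifest.
  ω : ℤ → ℕ → ℤ
  ω k i = - (((k - 1ℤ) choose i) * (ν k choose suc i) + ((ν k - 1ℤ) choose i) * (k choose suc i))

  ω-ν : ∀ k i → ω (ν k) i ≡ ω k i
  ω-ν k i rewrite ν-involutive k =
    cong -_ (+-comm (((ν k - 1ℤ) choose i) * (k choose suc i)) (((k - 1ℤ) choose i) * (ν k choose suc i)))

  -- After absorption both terms of `ω` are multiples of one product, by ν k and by k, and ν k + k =
  -- -1. This is the form of w with denominator j = i + 1.
  suc-ω : ∀ k i → + suc i * ω k i ≡ ((k - 1ℤ) choose i) * ((ν k - 1ℤ) choose i)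
  suc-ω k i = begin
    + suc i * - (A * (ν k choose suc i) + B * (k choose suc i))
      ≡⟨ l₁ (+ suc i) A (ν k choose suc i) B (k choose suc i) ⟩
    - (A * (+ suc i * (ν k choose suc i)) + B * (+ suc i * (k choose suc i)))
      ≡⟨ cong₂ (λ x y → - (A * x + B * y)) (choose-absorb′ (ν k) i) (choose-absorb′ k i) ⟩
    - (A * (ν k * B) + B * (k * A))
      ≡⟨ l₂ k A B ⟩
    A * B ∎
    where
    open ≡-Reasoning
    A = (k - 1ℤ) choose i
    B = (ν k - 1ℤ) choose i
    l₁ : ∀ s a x b y → s * - (a * x + b * y) ≡ - (a * (s * x) + b * (s * y))
    l₁ = solve-∀
    l₂ : ∀ k a b → - (a * ((-1ℤ + - k) * b) + b * (k * a)) ≡ a * b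
    l₂ = solve-∀

  -- Exchanges the denominator i + 1 for ν k = -(k + 1), which depends on k alone and is prime to p
  -- on suitable residue classes.
  ω-split : ∀ k i → ν k * ω k i ≡ ((k - 1ℤ) choose i) * (ν k choose suc i)
  ω-split k i = *-cancelˡ-≡ (+ suc i) _ _ (begin
    + suc i * (ν k * ω k i)               ≡⟨ l₁ (+ suc i) (ν k) (ω k i) ⟩
    ν k * (+ suc i * ω k i)               ≡⟨ cong (ν k *_) (suc-ω k i) ⟩
    ν k * (A * ((ν k - 1ℤ) choose i))     ≡⟨ l₁ (ν k) A _ ⟩
    A * (ν k * ((ν k - 1ℤ) choose i))     ≡⟨ cong (A *_) (choose-absorb′ (ν k) i) ⟨
    A * (+ suc i * (ν k choose suc i))    ≡⟨ l₁ A (+ suc i) _ ⟩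
    + suc i * (A * (ν k choose suc i))    ∎)
    where
    open ≡-Reasoning
    A = (k - 1ℤ) choose i
    l₁ : ∀ a b c → a * (b * c) ≡ b * (a * c)
    l₁ = solve-∀

-- Binomial coefficients digit by digit, and w on residue classes modulo p^m.

module Localisation where

  open import Data.Integer.Base as ℤ hiding (suc; pred; ∣_∣)
  open import Data.Integer.Divisibility.Signed
  open import Data.Integer.Properties
  open import Data.Integer.Tactic.RingSolver using (solve-∀)
  open import Data.List.Base using (List; []; _∷_; map)
  open import Data.Nat.Base as ℕ using (ℕ; zero; suc; z<s; s≤s)
  import Data.Nat.Divisibility as ℕ
  import Data.Nat.DivMod as ℕ
  import Data.Nat.Properties as ℕ
  open import Data.Nat.Primality using (Prime; prime⇒nonZero; prime⇒nonTrivial)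
  open import Data.Product.Base using (∃-syntax; _×_; _,_)
  open import Data.Sum.Base using (_⊎_; inj₁; inj₂)
  open import Data.Unit.Base using (tt)
  open import Relation.Binary.PropositionalEquality
  open import Relation.Binary.Definitions using (tri<; tri≈; tri>)
  open import Relation.Nullary using (¬_; yes; no; contradiction)
  open Binomials
  open Reflections

  lin : ℕ → List ℤ → ℤ → ℤ
  lin p []      a = 1ℤ
  lin p (u ∷ L) a = (+ p * a + u) * lin p L a

  lin-shift : ∀ p L a → lin p L (a - 1ℤ) ≡ lin p (map (_- + p) L) a
  lin-shift p []      a = refl
  lin-shift p (u ∷ L) a = cong₂ _*_ (eq (+ p) a u) (lin-shift p L a)
    where
    eq : ∀ p a u → p * (a - 1ℤ) + u ≡ p * a + (u - p)
    eq = solve-∀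

  V : ℕ → ℤ → ℤ
  V c k = (k choose c) * (ν k choose c)

  V-ν : ∀ c k → V c k ≡ V c (ν k)
  V-ν c k rewrite ν-involutive k = *-comm (k choose c) (ν k choose c)

  Z : ℕ → ℕ → ℤ → ℤ
  Z x y k = ((k - 1ℤ) choose x) * (ν k choose y)

  cls : ℕ → ℕ → ℤ → ℤ
  cls q ρ a = + q * a + + ρ

  -- `ω-split` needs only y = x + 1, but dividing both by p with remainder may make them equal; the
  -- disjunction is stable under this.
  Adjacent : ℕ → ℕ → Set
  Adjacent x y = y ≡ x ⊎ y ≡ suc x

  module _ {p : ℕ} (p-prime : Prime p) where

    private instance
      p≢0 : ℕ.NonZero p
      p≢0 = prime⇒nonZero p-prime

      +p≢0 : NonZero (+ p)
      +p≢0 = pos-nonZero p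

    1<p : 1 ℕ.< p
    1<p = ℕ.nonTrivial⇒n>1 p {{prime⇒nonTrivial p-prime}}

    quotient-remainder : ∀ n → ∃[ n′ ] ∃[ r ] n ≡ n′ ℕ.* p ℕ.+ r × r ℕ.< p
    quotient-remainder n =
      n ℕ./ p , n ℕ.% p ,
      trans (ℕ.m≡m%n+[m/n]*n n p) (ℕ.+-comm (n ℕ.% p) _) , ℕ.m%n<n n p

    ∤-residue : ∀ n r → 0 ℕ.< r → r ℕ.< p → ¬ + p ∣ + (n ℕ.* p ℕ.+ r)
    ∤-residue n (suc r) _ r<p p∣ =
      ℕ.>⇒∤ r<p (ℕ.∣m+n∣m⇒∣n (∣⇒∣ᵤ p∣) (ℕ.n∣m*n n))

    -- The values at a ↦ p a + b of a binomial coefficient, in terms of a function g of a and up to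
    -- a unit U and linear factors p a + u, which are harmless since they belong to Fine.
    record Rep (b n : ℕ) (g : ℤ → ℤ) : Set where
      field
        U   : ℤ
        p∤U : ¬ + p ∣ U
        L   : List ℤ
        eq  : ∀ a → U * ((+ p * a + + b) choose n) ≡ g a * lin p L a

    open Rep

    module _ {b n : ℕ} {g : ℤ → ℤ} (R : Rep b n g) where

      open ≡-Reasoning

      private
        k : ℤ → ℤ
        k a = + p * a + + b

        l₁ : ∀ x y z → x * (y * z) ≡ y * (x * z)
        l₁ = solve-∀

        absorbed : ∀ a → U R * (+ suc n * (k a choose suc n)) ≡ (k a - + n) * (g a * lin p (L R) a)
        absorbed a = begin
          U R * (+ suc n * (k a choose suc n))   ≡⟨ cong (U R *_) (choose-absorb (k a) n) ⟩
          U R * ((k a - + n) * (k a choose n))   ≡⟨ l₁ (U R) (k a - + n) _ ⟩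
          (k a - + n) * (U R * (k a choose n))   ≡⟨ cong ((k a - + n) *_) (eq R a) ⟩
          (k a - + n) * (g a * lin p (L R) a)    ∎

      rep-unit : ∀ {g′} L′ → ¬ + p ∣ + suc n →
                 (∀ a → (+ p * a + + b - + n) * (g a * lin p (L R) a) ≡ g′ a * lin p L′ a) →
                 Rep b (suc n) g′
      rep-unit L′ p∤ h = record
        { U = U R * + suc n ; p∤U = ∤-* p-prime (p∤U R) p∤ ; L = L′
        ; eq = λ a → trans (*-assoc (U R) (+ suc n) _) (trans (absorbed a) (h a)) }

      -- For n + 1 divisible by p: it cannot be absorbed into the unit `U`, so the numerator has to
      -- contain it explicitly.
      rep-divide : ∀ {g′} L′ →
                   (∀ a → (+ p * a + + b - + n) * (g a * lin p (L R) a) ≡ + suc n * (g′ a * lin p L′ a)) →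
                   Rep b (suc n) g′
      rep-divide L′ h = record
        { U = U R ; p∤U = p∤U R ; L = L′
        ; eq = λ a → *-cancelˡ-≡ (+ suc n) _ _
                 (trans (l₁ (+ suc n) (U R) _) (trans (absorbed a) (h a))) }

      linear-factor : ∀ a → (+ p * a + + b - + n) * (g a * lin p (L R) a) ≡
                            g a * lin p ((+ b - + n) ∷ L R) a
      linear-factor a = l (+ p * a) (+ b) (+ n) (g a) (lin p (L R) a)
        where
        l : ∀ x b n g l → (x + b - n) * (g * l) ≡ g * ((x + (b - n)) * l)
        l = solve-∀

      rep-step : ¬ + p ∣ + suc n → Rep b (suc n) g
      rep-step p∤ = rep-unit ((+ b - + n) ∷ L R) p∤ linear-factor

    -- Let k = p a + b and let n run from x p to (x + 1) p. The one factor k - n divisible by p is p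
    -- (a - x), at n = x p + b; the one denominator divisible by p is (x + 1) p, at the end. Between
    -- the two the coefficient carries the surplus p (a - x) C(a, x), which is `upper x`.
    lower upper : ℕ → ℤ → ℤ
    lower x a = a choose x
    upper x a = + p * (+ suc x * (a choose suc x))

    pos-n*p+r : ∀ x r → + (x ℕ.* p ℕ.+ r) ≡ + x * + p + + r
    pos-n*p+r x r = trans (pos-+ (x ℕ.* p) r) (cong (_+ + r) (pos-* x p))

    multiple-factor : ∀ b x a l → (+ p * a + + b - + (x ℕ.* p ℕ.+ b)) * (lower x a * l) ≡ upper x a * l
    multiple-factor b x a l = begin
      (+ p * a + + b - + (x ℕ.* p ℕ.+ b)) * (lower x a * l)
        ≡⟨ cong (λ u → (+ p * a + + b - u) * (lower x a * l)) (pos-n*p+r x b) ⟩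
      (+ p * a + + b - (+ x * + p + + b)) * (lower x a * l)
        ≡⟨ l₁ (+ p) a (+ b) (+ x) (lower x a) l ⟩
      + p * ((a - + x) * lower x a) * l
        ≡⟨ cong (λ u → + p * u * l) (choose-absorb a x) ⟨
      upper x a * l ∎
      where
      open ≡-Reasoning
      l₁ : ∀ p a b x c l → (p * a + b - (x * p + b)) * (c * l) ≡ p * ((a - x) * c) * l
      l₁ = solve-∀

    suc-residue : ∀ x r → suc r ℕ.< p → ¬ + p ∣ + suc (x ℕ.* p ℕ.+ r)
    suc-residue x r r+1<p =
      subst (λ n → ¬ + p ∣ + n) (ℕ.+-suc (x ℕ.* p) r) (∤-residue x (suc r) z<s r+1<p)

    rep-lower : ∀ {b} x r → r ℕ.≤ b → b ℕ.< p → Rep b (x ℕ.* p) (lower x) →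
                Rep b (x ℕ.* p ℕ.+ r) (lower x)
    rep-lower {b} x zero    r≤b b<p R = subst (λ n → Rep b n (lower x)) (sym (ℕ.+-identityʳ _)) R
    rep-lower {b} x (suc r) r<b b<p R =
      subst (λ n → Rep b n (lower x)) (sym (ℕ.+-suc (x ℕ.* p) r))
        (rep-step (rep-lower x r (ℕ.<⇒≤ r<b) b<p R) (suc-residue x r (ℕ.≤-<-trans r<b b<p)))

    rep-upper : ∀ {b} x d → suc d ℕ.+ b ℕ.< p → Rep b (x ℕ.* p) (lower x) →
                Rep b (x ℕ.* p ℕ.+ (suc d ℕ.+ b)) (upper x)
    rep-upper {b} x zero    b+1<p R =
      subst (λ n → Rep b n (upper x)) (sym (ℕ.+-suc (x ℕ.* p) b))
        (rep-unit R′ (L R′) (suc-residue x b b+1<p) (λ a → multiple-factor b x a (lin p (L R′) a)))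
      where
      R′ : Rep b (x ℕ.* p ℕ.+ b) (lower x)
      R′ = rep-lower x b ℕ.≤-refl (ℕ.<⇒≤ b+1<p) R
    rep-upper {b} x (suc d) lt R =
      subst (λ n → Rep b n (upper x)) (sym (ℕ.+-suc (x ℕ.* p) _))
        (rep-step (rep-upper x d (ℕ.<⇒≤ lt) R) (suc-residue x (suc d ℕ.+ b) lt))

    suc-block : ∀ x {r} → suc r ≡ p → suc (x ℕ.* p ℕ.+ r) ≡ suc x ℕ.* p
    suc-block x {r} e =
      trans (sym (ℕ.+-suc (x ℕ.* p) r)) (trans (cong (x ℕ.* p ℕ.+_) e) (ℕ.+-comm (x ℕ.* p) p))

    upper-lower : ∀ x a n l → suc n ≡ suc x ℕ.* p → upper x a * l ≡ + suc n * (lower (suc x) a * l)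
    upper-lower x a n l e = begin
      + p * (+ suc x * c) * l      ≡⟨ l₁ (+ p) (+ suc x) c l ⟩
      + suc x * + p * (c * l)      ≡⟨ cong (_* (c * l)) (trans (cong +_ e) (pos-* (suc x) p)) ⟨
      + suc n * (c * l)            ∎
      where
      open ≡-Reasoning
      c = a choose suc x
      l₁ : ∀ p s c l → p * (s * c) * l ≡ s * p * (c * l)
      l₁ = solve-∀

    rep-multiple : ∀ {b} → b ℕ.< p → ∀ x → Rep b (x ℕ.* p) (lower x)
    rep-multiple {b} b<p zero = record
      { U = 1ℤ ; p∤U = λ p∣1 → ℕ.>⇒∤ 1<p (∣⇒∣ᵤ p∣1) ; L = []
      ; eq = λ a → trans (cong (1ℤ *_) (choose-zero (+ p * a + + b))) (sym (cong (_* 1ℤ) (choose-zero a))) }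
    rep-multiple {b} b<p (suc x) with ℕ.<-cmp (suc b) p
    -- For b = p - 1 the numerator and the denominator divisible by p occur in the same step, and
    -- `upper` never arises in between.
    ... | tri≈ _ b+1≡p _ =
      subst (λ n → Rep b n (lower (suc x))) (suc-block x b+1≡p)
        (rep-divide R (L R) (λ a → trans (multiple-factor b x a (lin p (L R) a))
                               (upper-lower x a _ (lin p (L R) a) (suc-block x b+1≡p))))
      where
      R : Rep b (x ℕ.* p ℕ.+ b) (lower x)
      R = rep-lower x b ℕ.≤-refl b<p (rep-multiple b<p x)
    ... | tri> _ _ p<b+1 = contradiction p<b+1 (ℕ.≤⇒≯ b<p)
    ... | tri< b+1<p _ _ =
      subst (λ n → Rep b n (lower (suc x))) (suc-block x d+b≡p)
        (rep-divide R ((+ b - + (x ℕ.* p ℕ.+ (suc d ℕ.+ b))) ∷ L R) (λ a → trans (linear-factor R a)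
          (upper-lower x a _ (lin p ((+ b - + (x ℕ.* p ℕ.+ (suc d ℕ.+ b))) ∷ L R) a) (suc-block x d+b≡p))))
      where
      d = p ℕ.∸ suc (suc b)
      d+b≡p : suc (suc d ℕ.+ b) ≡ p
      d+b≡p = trans (cong suc (sym (ℕ.+-suc d b))) (trans (sym (ℕ.+-suc d (suc b))) (ℕ.m∸n+n≡m b+1<p))
      R : Rep b (x ℕ.* p ℕ.+ (suc d ℕ.+ b)) (upper x)
      R = rep-upper x d (ℕ.≤-reflexive d+b≡p) (rep-multiple b<p x)

    -- Keeps the surplus in the form p (x + 1) C(a, x + 1), so that it can be paired with a second
    -- factor of lower index x + 1.
    rep-last : ∀ {b} x r → suc b ℕ.< p → suc r ≡ p → Rep b (x ℕ.* p ℕ.+ r) (upper x)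
    rep-last {b} x r b+1<p r+1≡p =
      subst (λ r → Rep b (x ℕ.* p ℕ.+ r) (upper x)) d+b≡r
        (rep-upper x d (ℕ.≤-reflexive (trans (cong suc d+b≡r) r+1≡p)) (rep-multiple (ℕ.<⇒≤ b+1<p) x))
      where
      d = r ℕ.∸ suc b
      d+b≡r : suc d ℕ.+ b ≡ r
      d+b≡r = trans (sym (ℕ.+-suc d b)) (ℕ.m∸n+n≡m (ℕ.s≤s⁻¹ (subst (suc (suc b) ℕ.≤_) (sym r+1≡p) b+1<p)))

    rep : ∀ {b} x r → b ℕ.< p → r ℕ.< p → Rep b (x ℕ.* p ℕ.+ r) (lower x)
    rep {b} x r b<p r<p with r ℕ.≤? b
    ... | yes r≤b = rep-lower x r r≤b b<p (rep-multiple b<p x)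
    -- Beyond r = b the surplus p (a - x) is moved into the list of linear factors as p a - p x.
    ... | no  r≰b = record
      { U = U R ; p∤U = p∤U R ; L = (- (+ p * + x)) ∷ L R
      ; eq = λ a → trans (eq R a) (trans (cong (λ u → + p * u * lin p (L R) a) (choose-absorb a x))
                     (l (+ p) a (+ x) (lower x a) (lin p (L R) a))) }
      where
      d = r ℕ.∸ suc b
      d+b≡r : suc d ℕ.+ b ≡ r
      d+b≡r = trans (sym (ℕ.+-suc d b)) (ℕ.m∸n+n≡m (ℕ.≰⇒> r≰b))
      R : Rep b (x ℕ.* p ℕ.+ r) (upper x)
      R = subst (λ r → Rep b (x ℕ.* p ℕ.+ r) (upper x)) d+b≡r
            (rep-upper x d (subst (ℕ._< p) (sym d+b≡r) r<p) (rep-multiple b<p x))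
      l : ∀ p a x c l → p * ((a - x) * c) * l ≡ c * ((p * a + - (p * x)) * l)
      l = solve-∀

    -- All depths at once, because restriction to a residue class modulo p^m uses up m of them
    -- (`class-fine`).
    FINE : (ℤ → ℤ) → Set
    FINE f = ∀ s → Fine p s f

    lin-fine : ∀ L → FINE (lin p L)
    lin-fine []      s = Closed.con (fine-closed p-prime s) 1ℤ
    lin-fine (u ∷ L) s = Closed.mul (fine-closed p-prime s) (affine-fine p-prime s u) (lin-fine L s)

    fine-unit-multiple : ∀ s U {f g} → ¬ + p ∣ U → (∀ a → U * f a ≡ g a) → Fine p s g → Fine p s f
    fine-unit-multiple s U p∤U Uf≡g G =
      cancel (λ _ → p∤U) (con U) (ext (λ a → sym (Uf≡g a)) G)
      where open Closed (fine-closed p-prime s)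

    rep-product : ∀ {b b′ x y g g′} (R : Rep b x g) (R′ : Rep b′ y g′) a c →
      U R * U R′ * (((+ p * a + + b) choose x) * ((+ p * c + + b′) choose y)) ≡
      g a * g′ c * (lin p (L R) a * lin p (L R′) c)
    rep-product {b} {b′} {x} {y} {g} {g′} R R′ a c =
      trans (l (U R) (U R′) ((+ p * a + + b) choose x) ((+ p * c + + b′) choose y))
        (trans (cong₂ _*_ (eq R a) (eq R′ c)) (l (g a) (lin p (L R) a) (g′ c) (lin p (L R′) c)))
      where
      l : ∀ a b c d → a * b * (c * d) ≡ a * c * (b * d)
      l = solve-∀

    V-fine : ∀ s c → Good p s (V c) → Fine p s (V c)
    V-fine s c = ν-invariant⇒fine p-prime (good-closed p-prime s) (V-ν c)

    -- The digits of k and of ν k are complementary, so on a digit class both binomials reduce to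
    -- lower index c′, at a and at ν a: up to a unit and linear factors the product is `V c′` again.
    -- Being invariant under ν, that is fine as soon as it is good.
    V-good : ∀ s c → Good p s (V c)
    V-good zero    c = tt
    V-good (suc s) c {b} b<p with quotient-remainder c
    ... | c′ , r , refl , r<p =
      fine-unit-multiple s (U R * U R′) (∤-* p-prime (p∤U R) (p∤U R′))
        (λ a → trans (cong (λ k → U R * U R′ * (((+ p * a + + b) choose c) * (k choose c)))
                       (ν-digit p b b′ (∸-complement b<p) a))
                 (rep-product R R′ a (ν a)))
        (mul (V-fine s c′ (V-good s c′))
             (mul (lin-fine (L R) s) (refl-ν (lin-fine (L R′) s))))
      where
      open Closed (fine-closed p-prime s)
      b′ = p ℕ.∸ suc b
      R : Rep b (c′ ℕ.* p ℕ.+ r) (lower c′)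
      R = rep c′ r b<p r<p
      R′ : Rep b′ (c′ ℕ.* p ℕ.+ r) (lower c′)
      R′ = rep c′ r (∸-suc-< b<p) r<p

    cls-digit : ∀ m ρ b a → cls (p ℕ.^ suc m) (ρ ℕ.* p ℕ.+ b) a ≡ + p * cls (p ℕ.^ m) ρ a + + b
    cls-digit m ρ b a = begin
      + (p ℕ.* p ℕ.^ m) * a + + (ρ ℕ.* p ℕ.+ b)
        ≡⟨ cong₂ (λ u v → u * a + v) (pos-* p (p ℕ.^ m)) (pos-n*p+r ρ b) ⟩
      + p * + (p ℕ.^ m) * a + (+ ρ * + p + + b)
        ≡⟨ l (+ p) (+ (p ℕ.^ m)) a (+ ρ) (+ b) ⟩
      + p * (+ (p ℕ.^ m) * a + + ρ) + + b ∎
      where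
      open ≡-Reasoning
      l : ∀ p q a r b → p * q * a + (r * p + b) ≡ p * (q * a + r) + b
      l = solve-∀

    quotient-< : ∀ m {ρ b} → ρ ℕ.* p ℕ.+ b ℕ.< p ℕ.^ suc m → ρ ℕ.< p ℕ.^ m
    quotient-< m {ρ} {b} lt = ℕ.*-cancelʳ-< p ρ (p ℕ.^ m)
      (ℕ.≤-<-trans (ℕ.m≤m+n (ρ ℕ.* p) b) (subst (ρ ℕ.* p ℕ.+ b ℕ.<_) (ℕ.*-comm p (p ℕ.^ m)) lt))

    class-fine : ∀ {f} → FINE f → ∀ m ρ → ρ ℕ.< p ℕ.^ m → FINE (λ a → f (cls (p ℕ.^ m) ρ a))
    class-fine {f} F zero    zero    _  s = Closed.ext (fine-closed p-prime s)
      (λ a → cong f (sym (trans (+-identityʳ _) (*-identityˡ a)))) (F s)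
    class-fine {f} F zero    (suc _) (s≤s ())
    class-fine {f} F (suc m) ρ lt s with quotient-remainder ρ
    ... | ρ′ , b , refl , b<p = Closed.ext (fine-closed p-prime s) (λ a → cong f (sym (cls-digit m ρ′ b a)))
      (class-fine (λ s → FineBy.good (F (suc s)) b<p) m ρ′ (quotient-< m lt) s)

    -- If the quotients differ, then x ends in the digit p - 1; `adj` keeps this because it is the
    -- case handled by `rep-last`.
    record Quotients (x y : ℕ) : Set where
      field
        x′ x₀ y′ y₀ : ℕ
        x≡   : x ≡ x′ ℕ.* p ℕ.+ x₀
        y≡   : y ≡ y′ ℕ.* p ℕ.+ y₀
        x₀<p : x₀ ℕ.< p
        y₀<p : y₀ ℕ.< p
        adj  : y′ ≡ x′ ⊎ (y′ ≡ suc x′ × suc x₀ ≡ p)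

      adjacent : Adjacent x′ y′
      adjacent with adj
      ... | inj₁ e       = inj₁ e
      ... | inj₂ (e , _) = inj₂ e

    quotients : ∀ x y → Adjacent x y → Quotients x y
    quotients x y xy with quotient-remainder x
    quotients x _ (inj₁ refl) | x′ , r , e , r<p = record
      { x′ = x′ ; y′ = x′ ; x≡ = e ; y≡ = e ; x₀<p = r<p ; y₀<p = r<p ; adj = inj₁ refl }
    quotients x _ (inj₂ refl) | x′ , r , e , r<p with suc r ℕ.≟ p
    ... | yes r+1≡p = record
      { x′ = x′ ; y′ = suc x′ ; x≡ = e ; y≡ = trans (cong suc e) (trans (suc-block x′ r+1≡p) (sym (ℕ.+-identityʳ _)))
      ; x₀<p = r<p ; y₀<p = ℕ.<-trans z<s 1<p ; adj = inj₂ (refl , r+1≡p) }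
    ... | no  r+1≢p = record
      { x′ = x′ ; y′ = x′ ; x≡ = e ; y≡ = trans (cong suc e) (sym (ℕ.+-suc (x′ ℕ.* p) r))
      ; x₀<p = r<p ; y₀<p = ℕ.≤∧≢⇒< r<p r+1≢p ; adj = inj₁ refl }

    dig-pred : ∀ b a → + p * a + + suc b - 1ℤ ≡ + p * a + + b
    dig-pred b a = trans (cong (λ u → + p * a + u - 1ℤ) (pos-suc b)) (l (+ p * a) (+ b))
      where
      l : ∀ x b → x + (1ℤ + b) - 1ℤ ≡ x + b
      l = solve-∀

    -- With a nonzero lowest digit, k - 1 borrows nothing, so the binomials live over a and ν a and
    -- combine to some `V`. If y′ = x′ + 1, the first one is taken as p (x′ + 1) C(a, x′ + 1) to
    -- match the index of the second.
    Z-unit-digit : ∀ x y b → Adjacent x y → suc b ℕ.< p → FINE (dig p (suc b) (Z x y))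
    Z-unit-digit x y b xy b+1<p s with quotients x y xy
    ... | record { x′ = x′ ; x₀ = x₀ ; y′ = y′ ; y₀ = y₀ ; x≡ = refl ; y≡ = refl
                 ; x₀<p = x₀<p ; y₀<p = y₀<p ; adj = adj } = go adj
      where
      open Closed (fine-closed p-prime s)
      b′ = p ℕ.∸ suc (suc b)
      R′ : Rep b′ (y′ ℕ.* p ℕ.+ y₀) (lower y′)
      R′ = rep y′ y₀ (∸-suc-< b+1<p) y₀<p
      Z-digits : ∀ a → dig p (suc b) (Z x y) a ≡ ((+ p * a + + b) choose x) * ((+ p * ν a + + b′) choose y)
      Z-digits a = cong₂ (λ k l → (k choose x) * (l choose y))
                     (dig-pred b a) (ν-digit p (suc b) b′ (∸-complement b+1<p) a)
      go : y′ ≡ x′ ⊎ (y′ ≡ suc x′ × suc x₀ ≡ p) → Fine p s (dig p (suc b) (Z x y))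
      go (inj₁ refl) =
        fine-unit-multiple s (U R * U R′) (∤-* p-prime (p∤U R) (p∤U R′))
          (λ a → trans (cong (U R * U R′ *_) (Z-digits a)) (rep-product R R′ a (ν a)))
          (mul (V-fine s x′ (V-good s x′)) (mul (lin-fine (L R) s) (refl-ν (lin-fine (L R′) s))))
        where
        R : Rep b (x′ ℕ.* p ℕ.+ x₀) (lower x′)
        R = rep x′ x₀ (ℕ.<⇒≤ b+1<p) x₀<p
      go (inj₂ (refl , x₀+1≡p)) =
        fine-unit-multiple s (U R * U R′) (∤-* p-prime (p∤U R) (p∤U R′))
          (λ a → trans (cong (U R * U R′ *_) (Z-digits a))
            (trans (rep-product R R′ a (ν a))
              (cong (_* (lin p (L R) a * lin p (L R′) (ν a)))
                (l (+ p) (+ suc x′) (a choose suc x′) (ν a choose suc x′)))))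
          (mul (mul (con (+ p * + suc x′)) (V-fine s (suc x′) (V-good s (suc x′))))
               (mul (lin-fine (L R) s) (refl-ν (lin-fine (L R′) s))))
        where
        R : Rep b (x′ ℕ.* p ℕ.+ x₀) (upper x′)
        R = rep-last x′ x₀ b+1<p x₀+1≡p
        l : ∀ p s c d → p * (s * c) * d ≡ p * s * (c * d)
        l = solve-∀

    -- For k = p a the borrow gives k - 1 = p (a - 1) + (p - 1), so `Z` reproduces itself with the
    -- quotients of x and y.
    Z-zero-digit : ∀ x y (Q : Quotients x y) → ∃[ W ] ∃[ Λ ] ¬ + p ∣ W × FINE Λ ×
                   (∀ a → W * dig p 0 (Z x y) a ≡ Z (Quotients.x′ Q) (Quotients.y′ Q) a * Λ a)
    Z-zero-digit x y record { x′ = x′ ; x₀ = x₀ ; y′ = y′ ; y₀ = y₀ ; x≡ = refl ; y≡ = refl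
                            ; x₀<p = x₀<p ; y₀<p = y₀<p } =
      U R * U R′ , (λ a → lin p (L R) (a - 1ℤ) * lin p (L R′) (ν a)) ,
      ∤-* p-prime (p∤U R) (p∤U R′) ,
      (λ s → let open Closed (fine-closed p-prime s) in
        mul (ext (λ a → sym (lin-shift p (L R) a)) (lin-fine (map (_- + p) (L R)) s))
            (refl-ν (lin-fine (L R′) s))) ,
      (λ a → trans (cong (U R * U R′ *_) (cong₂ (λ k l → (k choose x) * (l choose y)) (pred-digit a) (ν-dig a)))
               (rep-product R R′ (a - 1ℤ) (ν a)))
      where
      b = ℕ.pred p
      b+1≡p : suc b ≡ p
      b+1≡p = ℕ.suc-pred p
      b<p : b ℕ.< p
      b<p = ℕ.≤-reflexive b+1≡p
      R : Rep b (x′ ℕ.* p ℕ.+ x₀) (lower x′)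
      R = rep x′ x₀ b<p x₀<p
      R′ : Rep b (y′ ℕ.* p ℕ.+ y₀) (lower y′)
      R′ = rep y′ y₀ b<p y₀<p
      ν-dig : ∀ a → ν (+ p * a + 0ℤ) ≡ + p * ν a + + b
      ν-dig = ν-digit p 0 b (trans (ℕ.+-comm b 1) b+1≡p)
      pred-digit : ∀ a → + p * a + 0ℤ - 1ℤ ≡ + p * (a - 1ℤ) + + b
      pred-digit a = subst (λ q → q * a + 0ℤ - 1ℤ ≡ q * (a - 1ℤ) + + b)
        (trans (sym (pos-suc b)) (cong +_ b+1≡p)) (l (+ b) a)
        where
        l : ∀ b a → (1ℤ + b) * a + 0ℤ - 1ℤ ≡ (1ℤ + b) * (a - 1ℤ) + b
        l = solve-∀

    -- Trailing zeros of ρ are peeled off by `Z-zero-digit` until a nonzero digit, which exists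
    -- because 0 < ρ, turns `Z` into some `V`.
    Z-class : ∀ m ρ x y → Adjacent x y → 0 ℕ.< ρ → ρ ℕ.< p ℕ.^ m →
              FINE (λ a → Z x y (cls (p ℕ.^ m) ρ a))
    Z-class zero    (suc ρ) x y xy _ (s≤s ())
    Z-class (suc m) ρ x y xy 0<ρ ρ< with quotient-remainder ρ
    ... | ρ′ , suc b , refl , b<p = λ s → Closed.ext (fine-closed p-prime s)
      (λ a → cong (Z x y) (sym (cls-digit m ρ′ (suc b) a)))
      (class-fine (Z-unit-digit x y b xy b<p) m ρ′ (quotient-< m ρ<) s)
    ... | suc ρ′ , zero , refl , b<p = λ s → Closed.ext (fine-closed p-prime s)
      (λ a → cong (Z x y) (sym (cls-digit m (suc ρ′) 0 a))) (go s (Z-zero-digit x y Q))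
      where
      Q : Quotients x y
      Q = quotients x y xy
      ρ′< : suc ρ′ ℕ.< p ℕ.^ m
      ρ′< = quotient-< m ρ<
      go : ∀ s → (∃[ W ] ∃[ Λ ] ¬ + p ∣ W × FINE Λ ×
                   (∀ a → W * dig p 0 (Z x y) a ≡ Z (Quotients.x′ Q) (Quotients.y′ Q) a * Λ a)) →
           Fine p s (λ a → dig p 0 (Z x y) (cls (p ℕ.^ m) (suc ρ′) a))
      go s (W , Λ , p∤W , Λ-fine , eq) = fine-unit-multiple s W p∤W (λ a → eq _)
        (Closed.mul (fine-closed p-prime s)
          (Z-class m (suc ρ′) (Quotients.x′ Q) (Quotients.y′ Q) (Quotients.adjacent Q) z<s ρ′< s)
          (class-fine Λ-fine m (suc ρ′) ρ′< s))

    cls-fine : ∀ m c → FINE (λ a → + (p ℕ.^ suc m) * a + c)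
    cls-fine m c s = add (ext (λ a → trans (sym (*-assoc (+ p) (+ (p ℕ.^ m)) a)) (cong (_* a) (sym (pos-* p (p ℕ.^ m)))))
        (p*-fine p-prime (good-closed p-prime s)
          (Closed.mul (good-closed p-prime s) (Closed.con (good-closed p-prime s) (+ (p ℕ.^ m))) (good-id p-prime s))))
      (con c)
      where open Closed (fine-closed p-prime s)

    ω-class-unit : ∀ m ρ i → 0 ℕ.< ρ → ρ ℕ.< p ℕ.^ m → ¬ p ℕ.∣ suc ρ →
                   FINE (λ a → ω (cls (p ℕ.^ m) ρ a) i)
    ω-class-unit zero    (suc ρ) i _ (s≤s ()) _
    ω-class-unit (suc m) ρ i 0<ρ ρ< p∤ρ+1 s =
      cancel p∤ν (add (con -1ℤ) (negate (cls-fine m (+ ρ) s)))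
        (ext (λ a → sym (ω-split (k a) i)) (Z-class (suc m) ρ i (suc i) (inj₂ refl) 0<ρ ρ< s))
      where
      open Closed (fine-closed p-prime s)
      k : ℤ → ℤ
      k = cls (p ℕ.^ suc m) ρ
      p∤ν : ∀ a → ¬ + p ∣ ν (k a)
      p∤ν a p∣ = p∤ρ+1 (∣⇒∣ᵤ (subst (+ p ∣_) (trans (l (ν (k a)) (+ (p ℕ.^ suc m) * a) (+ ρ) refl) (sym (pos-suc ρ)))
        (∣m⇒∣-m (∣m∣n⇒∣m+n p∣ (∣m⇒∣m*n a (subst (+ p ∣_) (sym (pos-* p (p ℕ.^ m))) (∣m⇒∣m*n (+ (p ℕ.^ m)) ∣-refl)))))))
        where
        l : ∀ n x r → n ≡ -1ℤ + - (x + r) → - (n + x) ≡ 1ℤ + r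
        l _ x r refl = l′ x r
          where
          l′ : ∀ x r → - (-1ℤ + - (x + r) + x) ≡ 1ℤ + r
          l′ = solve-∀

    -- If p divides ρ + 1, then ν carries the class to that of ρ″ = p^m - 1 - ρ, where ρ″ + 1 = p^m
    -- - ρ is prime to p. The bound on ρ + 1 keeps ρ″ positive.
    ω-class : ∀ m ρ i → 0 ℕ.< ρ → suc ρ ℕ.< p ℕ.^ m → FINE (λ a → ω (cls (p ℕ.^ m) ρ a) i)
    ω-class zero    ρ i _ (s≤s ())
    ω-class (suc m) ρ i 0<ρ ρ+1< with p ℕ.∣? suc ρ
    ... | no  p∤ = ω-class-unit (suc m) ρ i 0<ρ (ℕ.<⇒≤ ρ+1<) p∤
    ... | yes p∣ = λ s → Closed.ext (fine-closed p-prime s)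
      (λ a → trans (cong (λ k → ω k i) (sym (ν-digit q ρ ρ″ (∸-complement ρ<) a))) (ω-ν (cls q ρ a) i))
      (Closed.refl-ν (fine-closed p-prime s) (ω-class-unit (suc m) ρ″ i (ℕ.m<n⇒0<n∸m ρ+1<) (∸-suc-< ρ<) p∤ s))
      where
      q = p ℕ.^ suc m
      ρ″ = q ℕ.∸ suc ρ
      ρ< : ρ ℕ.< q
      ρ< = ℕ.<⇒≤ ρ+1<
      p∤ : ¬ p ℕ.∣ suc ρ″
      p∤ p∣ρ″+1 = ℕ.>⇒∤ 1<p (ℕ.∣m+n∣m⇒∣n (subst (p ℕ.∣_) (ℕ.+-comm 1 ρ″) p∣ρ″+1) p∣ρ″)
        where
        p∣ρ″ : p ℕ.∣ ρ″
        p∣ρ″ = ℕ.∣m+n∣m⇒∣n (subst (p ℕ.∣_) (sym (ℕ.m+[n∸m]≡n ρ<)) (ℕ.m∣m*n (p ℕ.^ m))) p∣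

-- Integer coefficient sequences under the Cauchy product.

module Series where

  open import Algebra.Bundles using (CommutativeMonoid)
  open import Data.Integer.Base as ℤ hiding (suc; pred; ∣_∣)
  open import Data.Integer.Properties
  open import Data.Integer.Tactic.RingSolver using (solve-∀)
  open import Data.Nat.Base as ℕ using (ℕ; zero; suc)
  open import Level using (0ℓ)
  open import Relation.Binary.PropositionalEquality
  open Folds

  Series : Set
  Series = ℕ → ℤ

  infix 4 _≈_

  _≈_ : Series → Series → Set
  A ≈ B = ∀ n → A n ≡ B n

  tail : Series → Series
  tail A n = A (suc n)

  infixl 7 _⊛_

  _⊛_ : Series → Series → Series
  (A ⊛ B) zero    = A 0 * B 0
  (A ⊛ B) (suc n) = A 0 * B (suc n) + (tail A ⊛ B) n

  one : Series
  one zero    = 1ℤ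
  one (suc _) = 0ℤ

  ⊛-cong : ∀ {A A′ B B′} → A ≈ A′ → B ≈ B′ → A ⊛ B ≈ A′ ⊛ B′
  ⊛-cong A≈ B≈ zero    = cong₂ _*_ (A≈ 0) (B≈ 0)
  ⊛-cong A≈ B≈ (suc n) =
    cong₂ _+_ (cong₂ _*_ (A≈ 0) (B≈ (suc n))) (⊛-cong (λ i → A≈ (suc i)) B≈ n)

  ⊛-suc : ∀ A B n → (A ⊛ B) (suc n) ≡ (A ⊛ tail B) n + A (suc n) * B 0
  ⊛-suc A B zero    = refl
  ⊛-suc A B (suc n) =
    trans (cong (_+_ (A 0 * B (suc (suc n)))) (⊛-suc (tail A) B n)) (sym (+-assoc (A 0 * B (suc (suc n))) _ _))

  ⊛-comm : ∀ A B → A ⊛ B ≈ B ⊛ A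
  ⊛-comm A B zero    = *-comm (A 0) (B 0)
  ⊛-comm A B (suc n) = begin
    A 0 * B (suc n) + (tail A ⊛ B) n  ≡⟨ cong₂ _+_ (*-comm (A 0) (B (suc n))) (⊛-comm (tail A) B n) ⟩
    B (suc n) * A 0 + (B ⊛ tail A) n  ≡⟨ +-comm (B (suc n) * A 0) _ ⟩
    (B ⊛ tail A) n + B (suc n) * A 0  ≡⟨ ⊛-suc B A n ⟨
    (B ⊛ A) (suc n)                   ∎
    where open ≡-Reasoning

  -- A combination of this shape is the tail of a Cauchy product, as associativity requires.
  ⊛-distrib : ∀ c A B C n → ((λ i → c * A i + B i) ⊛ C) n ≡ c * (A ⊛ C) n + (B ⊛ C) n
  ⊛-distrib c A B C zero    = l c (A 0) (B 0) (C 0)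
    where
    l : ∀ c a b x → (c * a + b) * x ≡ c * (a * x) + b * x
    l = solve-∀
  ⊛-distrib c A B C (suc n) =
    trans (cong (_+_ ((c * A 0 + B 0) * C (suc n))) (⊛-distrib c (tail A) (tail B) C n))
      (l c (A 0) (B 0) (C (suc n)) ((tail A ⊛ C) n) ((tail B ⊛ C) n))
    where
    l : ∀ c a b x y z → (c * a + b) * x + (c * y + z) ≡ c * (a * x + y) + (b * x + z)
    l = solve-∀

  ⊛-assoc : ∀ A B C → (A ⊛ B) ⊛ C ≈ A ⊛ (B ⊛ C)
  ⊛-assoc A B C zero    = *-assoc (A 0) (B 0) (C 0)
  ⊛-assoc A B C (suc n) = begin
    A 0 * B 0 * C (suc n) + ((λ i → A 0 * tail B i + (tail A ⊛ B) i) ⊛ C) n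
      ≡⟨ cong (_+_ (A 0 * B 0 * C (suc n))) (⊛-distrib (A 0) (tail B) (tail A ⊛ B) C n) ⟩
    A 0 * B 0 * C (suc n) + (A 0 * (tail B ⊛ C) n + ((tail A ⊛ B) ⊛ C) n)
      ≡⟨ cong (λ x → A 0 * B 0 * C (suc n) + (A 0 * (tail B ⊛ C) n + x)) (⊛-assoc (tail A) B C n) ⟩
    A 0 * B 0 * C (suc n) + (A 0 * (tail B ⊛ C) n + (tail A ⊛ (B ⊛ C)) n)
      ≡⟨ l (A 0) (B 0) (C (suc n)) ((tail B ⊛ C) n) ((tail A ⊛ (B ⊛ C)) n) ⟩
    A 0 * (B ⊛ C) (suc n) + (tail A ⊛ (B ⊛ C)) n ∎
    where
    open ≡-Reasoning
    l : ∀ a b c x y → a * b * c + (a * x + y) ≡ a * (b * c + x) + y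
    l = solve-∀

  zero-⊛ : ∀ B n → ((λ _ → 0ℤ) ⊛ B) n ≡ 0ℤ
  zero-⊛ B zero    = refl
  zero-⊛ B (suc n) = trans (+-identityˡ _) (zero-⊛ B n)

  one-⊛ : ∀ B → one ⊛ B ≈ B
  one-⊛ B zero    = *-identityˡ (B 0)
  one-⊛ B (suc n) = trans (cong₂ _+_ (*-identityˡ (B (suc n))) (zero-⊛ B n)) (+-identityʳ _)

  ⊛-commutativeMonoid : CommutativeMonoid 0ℓ 0ℓ
  ⊛-commutativeMonoid = record
    { Carrier = Series ; _≈_ = _≈_ ; _∙_ = _⊛_ ; ε = one
    ; isCommutativeMonoid = record
      { isMonoid = record
        { isSemigroup = record
          { isMagma = record
            { isEquivalence = record
              { refl = λ _ → refl ; sym = λ e n → sym (e n) ; trans = λ e f n → trans (e n) (f n) }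
            ; ∙-cong = ⊛-cong }
          ; assoc = ⊛-assoc }
        ; identity = one-⊛ , λ B n → trans (⊛-comm B one n) (one-⊛ B n) }
      ; comm = ⊛-comm } }
    where open import Data.Product.Base using (_,_)

  open Fold ⊛-commutativeMonoid public using () renaming
    ( fold to ∏ ; fold-cong to ∏-cong ; fold-rev to ∏-rev )

-- From balanced block sums to the divisibility of twice the sum.

module Descent where

  open import Data.Integer.Base as ℤ hiding (suc; pred; ∣_∣)
  open import Data.Integer.Divisibility.Signed
  open import Data.Integer.Properties
  open import Data.Integer.Tactic.RingSolver using (solve-∀)
  open import Data.Nat.Base as ℕ using (ℕ; zero; suc; z≤n; z<s; s≤s; s<s)
  import Data.Nat.Divisibility as ℕ
  open import Data.Nat.Induction using (<-rec)
  open import Data.List.Base using ([]; _∷_)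
  open import Data.List.Relation.Unary.All using (_∷_)
  open import Data.Nat.ListAction using (product)
  import Data.Nat.Properties as ℕ
  open import Data.Nat.Primality using (Prime; prime⇒nonZero; prime⇒nonTrivial)
  open import Data.Nat.Primality.Factorisation using (factorise)
  open import Data.Product.Base using (∃-syntax; _×_; _,_)
  open import Relation.Binary.PropositionalEquality
  open import Relation.Nullary using (Dec; ¬_; yes; no; contradiction)
  open Localisation
  open Reflections

  σ-block : ∀ p s f u → σ p s f u ≡ ∑ (p ℕ.^ s) (λ c → f (cls (p ℕ.^ s) c u))
  σ-block p zero    f u =
    trans (cong f (sym (trans (+-identityʳ _) (*-identityˡ u)))) (sym (+-identityʳ _))
  σ-block p (suc s) f u = begin
    ∑ p (λ b → σ p s (dig p b f) u)
      ≡⟨ ∑-cong p (λ {b} _ → σ-block p s (dig p b f) u) ⟩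
    ∑ p (λ b → ∑ q (λ c → f (+ p * cls q c u + + b)))
      ≡⟨ ∑-swap p q _ ⟩
    ∑ q (λ c → ∑ p (λ b → f (+ p * cls q c u + + b)))
      ≡⟨ ∑-cong q (λ {c} _ → ∑-cong p (λ {b} _ → cong f (eq c b))) ⟩
    ∑ q (λ c → ∑ p (λ b → f (cls (p ℕ.^ suc s) (c ℕ.* p ℕ.+ b) u)))
      ≡⟨ ∑-* q p _ ⟨
    ∑ (q ℕ.* p) (λ c → f (cls (p ℕ.^ suc s) c u))
      ≡⟨ cong (λ n → ∑ n (λ c → f (cls (p ℕ.^ suc s) c u))) (ℕ.*-comm q p) ⟩
    ∑ (p ℕ.^ suc s) (λ c → f (cls (p ℕ.^ suc s) c u)) ∎
    where
    open ≡-Reasoning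
    q = p ℕ.^ s
    eq : ∀ c b → + p * cls q c u + + b ≡ cls (p ℕ.^ suc s) (c ℕ.* p ℕ.+ b) u
    eq c b = begin
      + p * (+ q * u + + c) + + b                 ≡⟨ l (+ p) (+ q) u (+ c) (+ b) ⟩
      + p * + q * u + (+ c * + p + + b)           ≡⟨ cong₂ (λ x y → x * u + (y + + b)) (pos-* p q) (pos-* c p) ⟨
      + (p ℕ.* q) * u + (+ (c ℕ.* p) + + b)       ≡⟨ cong (_+_ (+ (p ℕ.* q) * u)) (pos-+ (c ℕ.* p) b) ⟨
      cls (p ℕ.^ suc s) (c ℕ.* p ℕ.+ b) u         ∎
      where
      l : ∀ p q u c b → p * (q * u + c) + b ≡ p * q * u + (c * p + b)
      l = solve-∀

  σ-blocks : ∀ p s f t → ∑ t (λ u → σ p s f (+ u)) ≡ ∑ (t ℕ.* p ℕ.^ s) (λ c → f (+ c))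
  σ-blocks p s f t = begin
    ∑ t (λ u → σ p s f (+ u))                             ≡⟨ ∑-cong t (λ {u} _ → σ-block p s f (+ u)) ⟩
    ∑ t (λ u → ∑ q (λ c → f (cls q c (+ u))))             ≡⟨ ∑-cong t (λ {u} _ → ∑-cong q (λ {c} _ → cong f (eq u c))) ⟩
    ∑ t (λ u → ∑ q (λ c → f (+ (u ℕ.* q ℕ.+ c))))         ≡⟨ ∑-* t q _ ⟨
    ∑ (t ℕ.* q) (λ c → f (+ c))                           ∎
    where
    open ≡-Reasoning
    q = p ℕ.^ s
    eq : ∀ u c → cls q c (+ u) ≡ + (u ℕ.* q ℕ.+ c)
    eq u c = trans (cong (_+ + c) (trans (*-comm (+ q) (+ u)) (sym (pos-* u q)))) (sym (pos-+ (u ℕ.* q) c))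

  ∑-sub : ∀ n f g → ∑ n (λ i → f i - g i) ≡ ∑ n f - ∑ n g
  ∑-sub n f g = trans (∑-+ n f (λ i → - g i)) (cong (_+_ (∑ n f)) (∑-neg n g))

  Hits : ℕ → ℕ → ℕ → Set
  Hits B q ρ = ∃[ l ] l ℕ.< suc B × q ℕ.∣ ρ ℕ.+ l

  -- B stands for 2β, and G k for the k-th summand (one of its coefficients).
  record Tame (B : ℕ) (G : ℤ → ℤ) : Set where
    field
      vanish : ∀ q k l → l ℕ.< suc B → + q ∣ k + + l → + q ∣ G k
      fine   : ∀ {p} (p-prime : Prime p) m ρ → Hits B (p ℕ.^ m) ρ → ¬ Hits B (p ℕ.^ suc m) ρ →
               ρ ℕ.< p ℕ.^ suc m →
               ∃[ f ] (∀ a → G (cls (p ℕ.^ suc m) ρ a) ≡ + (p ℕ.^ m) * f a) × FINE p-prime f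
      odd    : ∀ k → G (- + B - k) ≡ - G k

  module _ {B : ℕ} {G : ℤ → ℤ} (G-tame : Tame B G) where

    open Tame G-tame

    module _ {p : ℕ} (p-prime : Prime p) where

      -- The class is refined by one digit at a time. A subclass that p^(m+1) still hits is refined
      -- further, until `vanish` alone gives the whole power. On any other subclass G is p^m times a
      -- fine function, and `fine-balance` adds the remaining n + 1 factors, where n is the depth
      -- below that subclass.
      balance : ∀ n m ρ → ρ ℕ.< p ℕ.^ m → Hits B (p ℕ.^ m) ρ → ∀ u →
                + (p ℕ.^ (m ℕ.+ n)) ∣
                σ p n (λ a → G (cls (p ℕ.^ m) ρ a)) u - σ p n (λ a → G (cls (p ℕ.^ m) ρ a)) (ν u)
      balance zero m ρ ρ< (l , l< , q∣) u =
        subst (λ m → + (p ℕ.^ m) ∣ G (cls q ρ u) - G (cls q ρ (ν u))) (sym (ℕ.+-identityʳ m))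
          (∣m∣n⇒∣m-n (q∣G u) (q∣G (ν u)))
        where
        q = p ℕ.^ m
        q∣G : ∀ a → + q ∣ G (cls q ρ a)
        q∣G a = vanish q (cls q ρ a) l l< (subst (+ q ∣_)
          (trans (cong (_+_ (+ q * a)) (pos-+ ρ l)) (sym (+-assoc (+ q * a) (+ ρ) (+ l))))
          (∣m∣n⇒∣m+n (∣m⇒∣m*n a ∣-refl) (∣ᵤ⇒∣ q∣)))
      balance (suc n) m ρ ρ< (l , l< , q∣) u =
        subst (+ (p ℕ.^ (m ℕ.+ suc n)) ∣_) (∑-sub p (λ b → σ p n (dig p b H) u) (λ b → σ p n (dig p b H) (ν u)))
          (∑-∣ p digit)
        where
        q = p ℕ.^ m
        H : ℤ → ℤ
        H a = G (cls q ρ a)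
        D : (ℤ → ℤ) → ℤ
        D f = σ p n f u - σ p n f (ν u)
        digit : ∀ {b} → b ℕ.< p → + (p ℕ.^ (m ℕ.+ suc n)) ∣ D (dig p b H)
        digit {b} b<p =
          subst₂ (λ e x → + (p ℕ.^ e) ∣ x) (sym (ℕ.+-suc m n))
            (cong₂ _-_ (σ-cong p n cls≡ u) (σ-cong p n cls≡ (ν u)))
            (class (ℕ.anyUpTo? (λ l → p ℕ.^ suc m ℕ.∣? ρ′ ℕ.+ l) (suc B)))
          where
          ρ′ = b ℕ.* q ℕ.+ ρ
          ρ′< : ρ′ ℕ.< p ℕ.^ suc m
          ρ′< = ℕ.<-≤-trans (ℕ.+-monoʳ-< (b ℕ.* q) ρ<)
                  (ℕ.≤-trans (ℕ.≤-reflexive (ℕ.+-comm (b ℕ.* q) q)) (ℕ.*-monoˡ-≤ q b<p))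
          cls≡ : ∀ a → G (cls (p ℕ.^ suc m) ρ′ a) ≡ dig p b H a
          cls≡ a = cong G (begin
            + (p ℕ.* q) * a + + (b ℕ.* q ℕ.+ ρ)
              ≡⟨ cong₂ (λ x y → x * a + y) (pos-* p q) (trans (pos-+ (b ℕ.* q) ρ) (cong (_+ + ρ) (pos-* b q))) ⟩
            + p * + q * a + (+ b * + q + + ρ)
              ≡⟨ l₁ (+ p) (+ q) a (+ b) (+ ρ) ⟩
            + q * (+ p * a + + b) + + ρ ∎)
            where
            open ≡-Reasoning
            l₁ : ∀ p q a b r → p * q * a + (b * q + r) ≡ q * (p * a + b) + r
            l₁ = solve-∀
          q∣ρ′ : q ℕ.∣ ρ′ ℕ.+ l
          q∣ρ′ = subst (q ℕ.∣_) (sym (ℕ.+-assoc (b ℕ.* q) ρ l)) (ℕ.∣m∣n⇒∣m+n (ℕ.n∣m*n b) q∣)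
          class : Dec (Hits B (p ℕ.^ suc m) ρ′) →
                  + (p ℕ.^ (suc m ℕ.+ n)) ∣ D (λ a → G (cls (p ℕ.^ suc m) ρ′ a))
          class (yes hit) = balance n (suc m) ρ′ ρ′< hit u
          class (no miss) with fine p-prime m ρ′ (l , l< , q∣ρ′) miss ρ′<
          ... | f , G≡ , F = subst₂ _∣_
            (trans (sym (pos-* q (p ℕ.^ suc n))) (cong +_ (trans (sym (ℕ.^-distribˡ-+-* p m (suc n))) (cong (p ℕ.^_) (ℕ.+-suc m n)))))
            D≡ (*-monoʳ-∣ (+ q) (fine-balance p-prime n f (F n) u))
            where
            open ≡-Reasoning
            l₁ : ∀ q x y → q * (x - y) ≡ q * x - q * y
            l₁ = solve-∀
            σ≡ : ∀ v → + q * σ p n f v ≡ σ p n (λ a → G (cls (p ℕ.^ suc m) ρ′ a)) v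
            σ≡ v = trans (sym (σ-scale p n (+ q) f v)) (sym (σ-cong p n G≡ v))
            D≡ : + q * (σ p n f u - σ p n f (ν u)) ≡ D (λ a → G (cls (p ℕ.^ suc m) ρ′ a))
            D≡ = trans (l₁ (+ q) (σ p n f u) (σ p n f (ν u))) (cong₂ _-_ (σ≡ u) (σ≡ (ν u)))

      balance-sum : ∀ s t → let M = t ℕ.* p ℕ.^ s in
                    + (p ℕ.^ s) ∣ ∑ M (λ c → G (+ c)) - ∑ M (λ c → G (ν (+ c)))
      balance-sum s t = subst (+ (p ℕ.^ s) ∣_) sum-eq
        -- The refinement starts from the single class modulo p^0 = 1, which is hit trivially.
        (∑-∣ t (λ {u} _ → subst (+ (p ℕ.^ s) ∣_) (block-eq u) (balance s 0 0 z<s (0 , z<s , 1 ℕ.∣0) (+ u))))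
        where
        open ≡-Reasoning
        cls≡ : ∀ a → G (cls 1 0 a) ≡ G a
        cls≡ a = cong G (trans (+-identityʳ _) (*-identityˡ a))
        block-eq : ∀ u → σ p s (λ a → G (cls 1 0 a)) (+ u) - σ p s (λ a → G (cls 1 0 a)) (ν (+ u)) ≡
                         σ p s G (+ u) - σ p s (λ a → G (ν a)) (+ u)
        block-eq u = cong₂ _-_ (σ-cong p s cls≡ (+ u))
          (trans (σ-cong p s cls≡ (ν (+ u))) (sym (σ-ν p s G (+ u))))
        sum-eq : ∑ t (λ u → σ p s G (+ u) - σ p s (λ a → G (ν a)) (+ u)) ≡ _
        sum-eq = trans (∑-sub t _ _) (cong₂ _-_ (σ-blocks p s G t) (σ-blocks p s (λ a → G (ν a)) t))

    window : ℕ → ℕ → ℤ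
    window M x = ∑ M (λ c → G (+ c - + x))

    module _ {q M : ℕ} (q∣M : q ℕ.∣ M) where

      +q∣M : + q ∣ + M
      +q∣M = ∣ᵤ⇒∣ q∣M

      -- The shift exchanges the terms at -(x + 1) and M - (x + 1). Adding x + 1, which is at most
      -- B, to either argument gives a multiple of q, so both terms vanish modulo q.
      window-step : ∀ x → x ℕ.< B → + q ∣ window M (suc x) - window M x
      window-step x x<B = subst (+ q ∣_) (sym eq)
        (∣m∣n⇒∣m-n
          (vanish q (0ℤ - + suc x) (suc x) (s<s x<B) (subst (+ q ∣_) (sym (l₂ 0ℤ (+ suc x))) (divides 0ℤ refl)))
          (vanish q (+ M - + suc x) (suc x) (s<s x<B) (subst (+ q ∣_) (sym (l₂ (+ M) (+ suc x))) +q∣M)))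
        where
        open ≡-Reasoning
        l₁ : ∀ c x → 1ℤ + c - (1ℤ + x) ≡ c - x
        l₁ = solve-∀
        l₂ : ∀ a b → a - b + b ≡ a
        l₂ = solve-∀
        l₃ : ∀ a b c d → a + b ≡ c + d → c - b ≡ a - d
        l₃ a b c d e = trans (l₄ c b d) (trans (cong (λ y → y - b - d) (sym e)) (l₅ a b d))
          where
          l₄ : ∀ c b d → c - b ≡ c + d - b - d
          l₄ = solve-∀
          l₅ : ∀ a b d → a + b - b - d ≡ a - d
          l₅ = solve-∀
        shift : ∀ c → G (+ suc c - + suc x) ≡ G (+ c - + x)
        shift c = cong G (trans (cong₂ _-_ (pos-+ 1 c) (pos-+ 1 x)) (l₁ (+ c) (+ x)))
        eq : window M (suc x) - window M x ≡ G (0ℤ - + suc x) - G (+ M - + suc x)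
        eq = l₃ (G (0ℤ - + suc x)) (window M x) (window M (suc x)) (G (+ M - + suc x)) (begin
          G (0ℤ - + suc x) + window M x
            ≡⟨ cong (_+_ (G (0ℤ - + suc x))) (∑-cong M (λ {c} _ → shift c)) ⟨
          ∑ (suc M) (λ c → G (+ c - + suc x))
            ≡⟨ ∑-snoc M (λ c → G (+ c - + suc x)) ⟩
          window M (suc x) + G (+ M - + suc x) ∎)

      window-shift : ∀ x → x ℕ.≤ B → + q ∣ window M x - window M 0
      window-shift zero    _   = subst (+ q ∣_) (sym (+-inverseʳ (window M 0))) (divides 0ℤ refl)
      window-shift (suc x) x<B = subst (+ q ∣_) (l (window M (suc x)) (window M x) (window M 0))
        (∣m∣n⇒∣m+n (window-step x x<B) (window-shift x (ℕ.<⇒≤ x<B)))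
        where
        l : ∀ a b c → a - b + (b - c) ≡ a - c
        l = solve-∀

    window-zero : ∀ M → window M 0 ≡ ∑ M (λ c → G (+ c))
    window-zero M = ∑-cong M (λ {c} _ → cong G (+-identityʳ (+ c)))

    -- The centre of `odd` differs from that of ν: -1 - c = -B - (c - (B - 1)), whence the shift b =
    -- B - 1.
    reflected : ∀ M b → B ≡ suc b → ∑ M (λ c → G (ν (+ c))) ≡ - window M b
    reflected M b refl = trans (∑-cong M (λ {c} _ → reflect c)) (∑-neg M _)
      where
      reflect : ∀ c → G (ν (+ c)) ≡ - G (+ c - + b)
      reflect c = trans (cong G (trans (l (+ c) (+ b)) (cong (λ y → - y - (+ c - + b)) (sym (pos-+ 1 b))))) (odd _)
        where
        l : ∀ c b → -1ℤ + - c ≡ - (1ℤ + b) - (c - b)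
        l = solve-∀

    -- Modulo q, `W₀ + W₁` vanishes by balance and `W₁` agrees with `W₀` by shifting, so only
    -- `+ 2 * W₀` is known to vanish. `W₀` agrees with `S`, as the terms at 0, at M and in `T` are
    -- multiples of q.
    prime-power-∣ : ∀ {p} → Prime p → ∀ s n e → e ℕ.≤ suc B → 0 ℕ.< B → p ℕ.^ s ℕ.∣ n ℕ.+ e →
                    + (p ℕ.^ s) ∣ + 2 * ∑ n (λ k → G (+ suc k))
    prime-power-∣ {p} p-prime s n e e≤ 0<B q∣M@(ℕ.divides t M≡) = subst (+ q ∣_) eq
      (∣m∣n⇒∣m+n (∣m∣n⇒∣m-n bal (window-shift q∣M b (ℕ.≤-trans (ℕ.n≤1+n b) (ℕ.≤-reflexive (sym B≡)))))
        (∣n⇒∣m*n (+ 2) (∣m∣n⇒∣m-n (vanish q (+ M) 0 z<s (subst (+ q ∣_) (sym (+-identityʳ (+ M))) (∣ᵤ⇒∣ q∣M)))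
          (∣m∣n⇒∣m+n (vanish q 0ℤ 0 z<s (divides 0ℤ refl)) rest))))
      where
      open ≡-Reasoning
      q = p ℕ.^ s
      M = n ℕ.+ e
      b = ℕ.pred B
      B≡ : B ≡ suc b
      B≡ = sym (ℕ.suc-pred B {{ℕ.>-nonZero 0<B}})
      S = ∑ n (λ k → G (+ suc k))
      T = ∑ e (λ j → G (+ suc (n ℕ.+ j)))
      W₀ = window M 0
      W₁ = window M b
      bal : + q ∣ W₀ + W₁
      bal = subst (+ q ∣_)
        (trans (cong₂ _-_ (trans (cong (λ m → ∑ m (λ c → G (+ c))) (sym M≡)) (sym (window-zero M)))
                          (trans (cong (λ m → ∑ m (λ c → G (ν (+ c)))) (sym M≡)) (reflected M b B≡)))
          (cong (_+_ W₀) (neg-involutive W₁)))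
        (balance-sum p-prime s t)
      -- From n + 1 + j the multiple M is e - 1 - j steps away, which is at most B exactly because e
      -- ≤ B + 1.
      rest : + q ∣ T
      rest = ∑-∣ e (λ {j} j<e → vanish q (+ suc (n ℕ.+ j)) (e ℕ.∸ suc j)
        (ℕ.<-≤-trans (∸-suc-< j<e) e≤)
        (subst (λ m → + q ∣ + m) (sym (index j<e)) (∣ᵤ⇒∣ q∣M)))
        where
        index : ∀ {j} → j ℕ.< e → suc (n ℕ.+ j) ℕ.+ (e ℕ.∸ suc j) ≡ M
        index {j} j<e = trans (cong (ℕ._+ (e ℕ.∸ suc j)) (sym (ℕ.+-suc n j)))
          (trans (ℕ.+-assoc n (suc j) _) (cong (n ℕ.+_) (ℕ.m+[n∸m]≡n j<e)))
      total : G 0ℤ + (S + T) ≡ W₀ + G (+ M)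
      total = begin
        G 0ℤ + (S + T)                     ≡⟨ cong (_+_ (G 0ℤ)) (∑-split n e (λ k → G (+ suc k))) ⟨
        ∑ (suc M) (λ c → G (+ c))          ≡⟨ ∑-snoc M (λ c → G (+ c)) ⟩
        ∑ M (λ c → G (+ c)) + G (+ M)      ≡⟨ cong (_+ G (+ M)) (window-zero M) ⟨
        W₀ + G (+ M)                       ∎
      eq : W₀ + W₁ - (W₁ - W₀) + + 2 * (G (+ M) - (G 0ℤ + T)) ≡ + 2 * S
      eq = begin
        W₀ + W₁ - (W₁ - W₀) + + 2 * (G (+ M) - (G 0ℤ + T))  ≡⟨ l₁ W₀ W₁ (G (+ M)) (G 0ℤ) T ⟩
        + 2 * (W₀ + G (+ M)) - + 2 * (G 0ℤ + T)             ≡⟨ cong (λ x → + 2 * x - + 2 * (G 0ℤ + T)) total ⟨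
        + 2 * (G 0ℤ + (S + T)) - + 2 * (G 0ℤ + T)           ≡⟨ l₂ (G 0ℤ) S T ⟩
        + 2 * S                                             ∎
        where
        l₁ : ∀ a b m z t → a + b - (b - a) + + 2 * (m - (z + t)) ≡ + 2 * (a + m) - + 2 * (z + t)
        l₁ = solve-∀
        l₂ : ∀ z s t → + 2 * (z + (s + t)) - + 2 * (z + t) ≡ + 2 * s
        l₂ = solve-∀

  ∃-prime-divisor : ∀ n → 1 ℕ.< n → ∃[ p ] Prime p × p ℕ.∣ n
  ∃-prime-divisor n@(suc _) 1<n with factorise n
  ... | record { factors = []     ; isFactorisation = n≡1 } = contradiction (sym n≡1) (ℕ.<⇒≢ 1<n)
  ... | record { factors = p ∷ ps ; isFactorisation = n≡ ; factorsPrime = p-prime ∷ _ } =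
    p , p-prime , subst (p ℕ.∣_) (sym n≡) (ℕ.m∣m*n (product ps))

  remove-prime : ∀ {p} → Prime p → ∀ n → .{{ℕ.NonZero n}} →
                 ∃[ s ] ∃[ m ] n ≡ m ℕ.* p ℕ.^ s × ¬ p ℕ.∣ m
  remove-prime {p} p-prime = <-rec (λ n → .{{ℕ.NonZero n}} → ∃[ s ] ∃[ m ] n ≡ m ℕ.* p ℕ.^ s × ¬ p ℕ.∣ m) step
    where
    step : ∀ n → (∀ {k} → k ℕ.< n → .{{ℕ.NonZero k}} → ∃[ s ] ∃[ m ] k ≡ m ℕ.* p ℕ.^ s × ¬ p ℕ.∣ m) →
           .{{ℕ.NonZero n}} → ∃[ s ] ∃[ m ] n ≡ m ℕ.* p ℕ.^ s × ¬ p ℕ.∣ m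
    step n@(suc _) rec with p ℕ.∣? n
    ... | no p∤n = 0 , n , sym (ℕ.*-identityʳ n) , p∤n
    ... | yes (ℕ.divides k@(suc _) n≡) with rec {k} (subst (k ℕ.<_) (sym n≡) (ℕ.m<m*n k p (ℕ.nonTrivial⇒n>1 p {{prime⇒nonTrivial p-prime}})))
    ...   | s , m , k≡ , p∤m = suc s , m , trans n≡ (trans (cong (ℕ._* p) k≡)
              (trans (ℕ.*-assoc m (p ℕ.^ s) p) (cong (m ℕ.*_) (ℕ.*-comm (p ℕ.^ s) p)))) , p∤m

  -- With n = m p^s, s maximal, induction gives m ∣ X; since p does not divide m, the power p^s
  -- divides the quotient X / m.
  prime-powers-∣ : ∀ n X → .{{ℕ.NonZero n}} →
                   (∀ {p} → Prime p → ∀ s → p ℕ.^ s ℕ.∣ n → + (p ℕ.^ s) ∣ X) → + n ∣ X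
  prime-powers-∣ = <-rec _ step
    where
    step : ∀ n → (∀ {k} → k ℕ.< n → ∀ X → .{{ℕ.NonZero k}} →
                   (∀ {p} → Prime p → ∀ s → p ℕ.^ s ℕ.∣ k → + (p ℕ.^ s) ∣ X) → + k ∣ X) →
           ∀ X → .{{ℕ.NonZero n}} →
           (∀ {p} → Prime p → ∀ s → p ℕ.^ s ℕ.∣ n → + (p ℕ.^ s) ∣ X) → + n ∣ X
    step 1 rec X h = divides X (sym (*-identityʳ X))
    step n@(suc (suc _)) rec X h with ∃-prime-divisor n (s≤s (s≤s z≤n))
    ... | p , p-prime , p∣n with remove-prime p-prime n
    ...   | zero  , m , n≡ , p∤m = contradiction (subst (p ℕ.∣_) (trans n≡ (ℕ.*-identityʳ m)) p∣n) p∤m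
    ...   | suc s , m@(suc _) , n≡ , p∤m = subst₂ _∣_ (trans (sym (pos-* m q)) (cong +_ (sym n≡)))
              (trans (*-comm (+ m) z) (sym (_∣_.equality m∣X)))
              (*-monoʳ-∣ (+ m) q∣z)
      where
      q = p ℕ.^ suc s
      1<q : 1 ℕ.< q
      1<q = ℕ.<-≤-trans (ℕ.nonTrivial⇒n>1 p {{prime⇒nonTrivial p-prime}})
              (ℕ.m≤m*n p (p ℕ.^ s) {{ℕ.m^n≢0 p s {{prime⇒nonZero p-prime}}}})
      m<n : m ℕ.< n
      m<n = subst (m ℕ.<_) (sym n≡) (ℕ.m<m*n m q 1<q)
      m∣X : + m ∣ X
      m∣X = rec m<n X (λ r-prime t r∣m → h r-prime t (ℕ.∣-trans r∣m (subst (m ℕ.∣_) (sym n≡) (ℕ.m∣m*n q))))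
      z : ℤ
      z = quotient m∣X
      q∣z : + q ∣ z
      q∣z = prime-power-cancel p-prime (suc s) (+ m) z (λ p∣m → p∤m (∣⇒∣ᵤ p∣m))
        (subst (+ q ∣_) (trans (_∣_.equality m∣X) (*-comm z (+ m))) (h p-prime (suc s) (subst (q ℕ.∣_) (sym n≡) (ℕ.n∣m*n m))))

  tame-∣ : ∀ {B G} → Tame B G → 0 ℕ.< B → ∀ n e → .{{ℕ.NonZero n}} → e ℕ.≤ suc B →
           + (n ℕ.+ e) ∣ + 2 * ∑ n (λ k → G (+ suc k))
  tame-∣ G-tame 0<B n@(suc _) e e≤ =
    prime-powers-∣ (n ℕ.+ e) _ (λ p-prime s q∣ → prime-power-∣ G-tame p-prime s n e e≤ 0<B q∣)

-- The summand of the theorem on all integers: vanishing, fineness and oddness.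

module Summand where

  open import Data.Integer.Base as ℤ hiding (suc; pred; ∣_∣)
  open import Data.Integer.Divisibility.Signed
  open import Data.Integer.Properties
  open import Data.Integer.Tactic.RingSolver using (solve-∀)
  open import Data.Nat.Base as ℕ using (ℕ; zero; suc; z<s; s<s)
  import Data.Nat.Divisibility as ℕ
  import Data.Nat.Properties as ℕ
  open import Data.Nat.Primality using (Prime)
  open import Data.Product.Base using (∃-syntax; _×_; _,_)
  open import Relation.Binary.Definitions using (tri<; tri≈; tri>)
  open import Relation.Binary.PropositionalEquality
  open import Relation.Nullary using (¬_)
  open Binomials
  open Descent
  open Folds
  open Localisation
  open Reflections
  open Series

  open Fold *-1-commutativeMonoid public using () renaming
    ( fold to Π ; fold-cong to Π-cong ; fold-snoc to Π-snoc ; fold-rev to Π-rev ; fold-∙ to Π-* )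

  -- Only classes modulo p^(m+1) occur: modulo 1 even the function k would fail, as k - ν k = 2k +
  -- 1.
  record Poly (f : ℤ → ℤ) : Set where
    constructor poly
    field
      on-class : ∀ {p} (p-prime : Prime p) m ρ → FINE p-prime (λ a → f (cls (p ℕ.^ suc m) ρ a))

  open Poly

  poly-con : ∀ c → Poly (λ _ → c)
  poly-con c = poly λ p-prime m ρ s → Closed.con (fine-closed p-prime s) c

  poly-* : ∀ {f g} → Poly f → Poly g → Poly (λ k → f k * g k)
  poly-* F G = poly λ p-prime m ρ s →
    Closed.mul (fine-closed p-prime s) (on-class F p-prime m ρ s) (on-class G p-prime m ρ s)

  poly-linear : ∀ c → Poly (λ k → k + c)
  poly-linear c = poly λ {p} p-prime m ρ s →
    Closed.ext (fine-closed p-prime s) (λ a → sym (+-assoc (+ (p ℕ.^ suc m) * a) (+ ρ) c))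
      (cls-fine p-prime m (+ ρ + c) s)

  poly-Π : ∀ n {f : ℤ → ℕ → ℤ} → (∀ i → Poly (λ k → f k i)) → Poly (λ k → Π n (f k))
  poly-Π zero        F = poly-con 1ℤ
  poly-Π (suc n) {f} F = poly-* (F 0) (poly-Π n {λ k i → f k (suc i)} (λ i → F (suc i)))

  poly-^ : ∀ n {f} → Poly f → Poly (λ k → f k ^ n)
  poly-^ zero    F = poly-con 1ℤ
  poly-^ (suc n) F = poly-* F (poly-^ n F)

  record HasFactor (c : ℤ) (f : ℤ → ℤ) : Set where
    constructor factored
    field
      cofactor      : ℤ → ℤ
      factor-eq     : ∀ k → f k ≡ (k + c) * cofactor k
      cofactor-poly : Poly cofactor

  factor-*ˡ : ∀ {c f g} → HasFactor c f → Poly g → HasFactor c (λ k → f k * g k)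
  factor-*ˡ {c} {g = g} (factored h eq H) G =
    factored (λ k → h k * g k) (λ k → trans (cong (_* g k) (eq k)) (*-assoc (k + c) (h k) (g k))) (poly-* H G)

  factor-*ʳ : ∀ {c f g} → Poly f → HasFactor c g → HasFactor c (λ k → f k * g k)
  factor-*ʳ {c} {f} {g} F G with factor-*ˡ G F
  ... | factored h eq H = factored h (λ k → trans (*-comm (f k) (g k)) (eq k)) H

  factor-Π : ∀ n {c} {f : ℤ → ℕ → ℤ} i → i ℕ.< n → (∀ i → Poly (λ k → f k i)) →
             HasFactor c (λ k → f k i) → HasFactor c (λ k → Π n (f k))
  factor-Π (suc n) {f = f} zero    _         F H =
    factor-*ˡ H (poly-Π n {λ k i → f k (suc i)} (λ i → F (suc i)))
  factor-Π (suc n) {f = f} (suc i) (s<s i<n) F H =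
    factor-*ʳ (F 0) (factor-Π n {f = λ k i → f k (suc i)} i i<n (λ i → F (suc i)) H)

  factor-linear : ∀ c → HasFactor c (λ k → k + c)
  factor-linear c = factored (λ _ → 1ℤ) (λ k → sym (*-identityʳ (k + c))) (poly-con 1ℤ)

  W : ℤ → Series
  W k j = -1ℤ ^ j * ω k j

  module _ (β α m r : ℕ) where

    B : ℕ
    B = 2 ℕ.* β

    -- The two factors are exchanged, up to signs that cancel, by k ↦ -B - k. The pairs with l < β
    -- make up (k)_β (k+β+1)_β (`Π-pair`).
    pair : ℤ → ℕ → ℤ
    pair k l = (k + + l) * (k + + (B ℕ.∸ l))

    weight : ℤ → ℤ
    weight k = Π β (pair k) ^ suc r * (k + + β)

    base : ℤ → Series
    base k j = W k j ^ α

    power : ℤ → Series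
    power k = ∏ m (λ _ → base k)

    coeffs : ℤ → Series
    coeffs k = ∏ B (λ i → power (k + + i))

    summand : ℕ → ℤ → ℤ
    summand d k = weight k * coeffs k d

    poly-pair : ∀ l → Poly (λ k → pair k l)
    poly-pair l = poly-* (poly-linear (+ l)) (poly-linear (+ (B ℕ.∸ l)))

    B≡β+β : B ≡ β ℕ.+ β
    B≡β+β = cong (β ℕ.+_) (ℕ.+-identityʳ β)

    -- k + l is the centre for l = β, the first factor of pair l for l < β, and the second factor of
    -- pair B - l for l > β. The exponent `suc r` guarantees one copy of each pair.
    weight-factor : ∀ l → l ℕ.< suc B → HasFactor (+ l) weight
    weight-factor l l≤B with ℕ.<-cmp l β
    ... | tri≈ _ refl _ = factor-*ʳ (poly-^ (suc r) (poly-Π β poly-pair)) (factor-linear (+ l))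
    ... | tri< l<β _ _ = factor-*ˡ (factor-*ˡ
      (factor-Π β l l<β poly-pair (factor-*ˡ (factor-linear (+ l)) (poly-linear (+ (B ℕ.∸ l)))))
      (poly-^ r (poly-Π β poly-pair))) (poly-linear (+ β))
    ... | tri> _ _ β<l = factor-*ˡ (factor-*ˡ
      (factor-Π β (B ℕ.∸ l) l′<β poly-pair (factor-*ʳ (poly-linear (+ (B ℕ.∸ l)))
        (subst (λ i → HasFactor (+ l) (λ k → k + + i)) (sym (ℕ.m∸[m∸n]≡n (ℕ.s≤s⁻¹ l≤B))) (factor-linear (+ l)))))
      (poly-^ r (poly-Π β poly-pair))) (poly-linear (+ β))
      where
      l′<β : B ℕ.∸ l ℕ.< β
      l′<β = subst (λ b → b ℕ.∸ l ℕ.< β) (sym B≡β+β)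
        (ℕ.<-≤-trans (ℕ.∸-monoʳ-< β<l (subst (l ℕ.≤_) B≡β+β (ℕ.s≤s⁻¹ l≤B))) (ℕ.≤-reflexive (ℕ.m+n∸n≡m β β)))

    pair-reflect : ∀ k {l} → l ℕ.≤ B → pair (- + B - k) l ≡ pair k l
    pair-reflect k {l} l≤B = begin
      (- + B - k + + l) * (- + B - k + + (B ℕ.∸ l))  ≡⟨ cong (λ b → (- b - k + + l) * (- b - k + + (B ℕ.∸ l))) B-split ⟩
      (- (+ l + + (B ℕ.∸ l)) - k + + l) * (- (+ l + + (B ℕ.∸ l)) - k + + (B ℕ.∸ l))
        ≡⟨ l₁ k (+ l) (+ (B ℕ.∸ l)) ⟩
      pair k l ∎
      where
      open ≡-Reasoning
      B-split : + B ≡ + l + + (B ℕ.∸ l)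
      B-split = trans (cong +_ (sym (ℕ.m+[n∸m]≡n l≤B))) (pos-+ l (B ℕ.∸ l))
      l₁ : ∀ k x y → (- (x + y) - k + x) * (- (x + y) - k + y) ≡ (k + x) * (k + y)
      l₁ = solve-∀

    β≤B : β ℕ.≤ B
    β≤B = ℕ.m≤n*m β 2

    weight-odd : ∀ k → weight (- + B - k) ≡ - weight k
    weight-odd k = begin
      Π β (pair (- + B - k)) ^ suc r * (- + B - k + + β)
        ≡⟨ cong₂ (λ x y → x ^ suc r * y)
             (Π-cong β (λ l<β → pair-reflect k (ℕ.≤-trans (ℕ.<⇒≤ l<β) β≤B))) centre ⟩
      Π β (pair k) ^ suc r * - (k + + β)
        ≡⟨ neg-distribʳ-* (Π β (pair k) ^ suc r) (k + + β) ⟨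
      - weight k ∎
      where
      open ≡-Reasoning
      l₁ : ∀ k b → - (b + b) - k + b ≡ - (k + b)
      l₁ = solve-∀
      centre : - + B - k + + β ≡ - (k + + β)
      centre = trans (cong (λ b → - b - k + + β) (trans (cong +_ B≡β+β) (pos-+ β β))) (l₁ k (+ β))

    power-ν : ∀ k → power (ν k) ≈ power k
    power-ν k = ∏-cong m (λ _ j → cong (λ x → (-1ℤ ^ j * x) ^ α) (ω-ν k j))

    -- The reflection sends index i to B - 1 - i combined with ν, so the symmetry of w leaves the
    -- same product in reverse order.
    coeffs-even : ∀ k → coeffs (- + B - k) ≈ coeffs k
    coeffs-even k d = trans
      (∏-cong B (λ {i} i<B j → trans (cong (λ x → power x j) (reflect i<B)) (power-ν (k + + (B ℕ.∸ suc i)) j)) d)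
      (sym (∏-rev B (λ i → power (k + + i)) d))
      where
      reflect : ∀ {i} → i ℕ.< B → - + B - k + + i ≡ ν (k + + (B ℕ.∸ suc i))
      reflect {i} i<B = trans (cong (λ b → - b - k + + i) B-split) (l₁ k (+ i) (+ (B ℕ.∸ suc i)))
        where
        B-split : + B ≡ 1ℤ + + i + + (B ℕ.∸ suc i)
        B-split = trans (cong +_ (sym (ℕ.m+[n∸m]≡n i<B)))
          (trans (pos-+ (suc i) (B ℕ.∸ suc i)) (cong (_+ + (B ℕ.∸ suc i)) (pos-+ 1 i)))
        l₁ : ∀ k x y → - (1ℤ + x + y) - k + x ≡ -1ℤ + - (k + y)
        l₁ = solve-∀

    module _ {p : ℕ} (p-prime : Prime p) where

      FineSeries : (ℤ → Series) → Set
      FineSeries F = ∀ d → FINE p-prime (λ a → F a d)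

      one-fine : FineSeries (λ _ → one)
      one-fine zero    s = Closed.con (fine-closed p-prime s) 1ℤ
      one-fine (suc d) s = Closed.con (fine-closed p-prime s) 0ℤ

      ⊛-fine : ∀ {F G} → FineSeries F → FineSeries G → FineSeries (λ a → F a ⊛ G a)
      ⊛-fine F G zero    s = Closed.mul (fine-closed p-prime s) (F 0 s) (G 0 s)
      ⊛-fine F G (suc d) s = add (mul (F 0 s) (G (suc d) s)) (⊛-fine (λ d → F (suc d)) G d s)
        where open Closed (fine-closed p-prime s)

      ∏-fine : ∀ n {F : ℤ → ℕ → Series} → (∀ {i} → i ℕ.< n → FineSeries (λ a → F a i)) →
               FineSeries (λ a → ∏ n (F a))
      ∏-fine zero    F = one-fine
      ∏-fine (suc n) F = ⊛-fine (F z<s) (∏-fine n (λ i<n → F (s<s i<n)))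

      ^-fine : ∀ n {f} → FINE p-prime f → FINE p-prime (λ a → f a ^ n)
      ^-fine zero    F s = Closed.con (fine-closed p-prime s) 1ℤ
      ^-fine (suc n) F s = Closed.mul (fine-closed p-prime s) (F s) (^-fine n F s)

      coeffs-fine : ∀ m′ ρ → ρ ℕ.< p ℕ.^ m′ → ¬ Hits B (p ℕ.^ m′) ρ →
                    FineSeries (λ a → coeffs (cls (p ℕ.^ m′) ρ a))
      coeffs-fine m′ ρ ρ<q miss = ∏-fine B (λ i<B → ∏-fine m (λ _ j → ^-fine α (W-fine i<B j)))
        where
        q = p ℕ.^ m′
        0<ρ : 0 ℕ.< ρ
        0<ρ = ℕ.n≢0⇒n>0 (λ { refl → miss (0 , z<s , q ℕ.∣0) })
        -- Consecutive integers starting below q cannot pass q without meeting it, and meeting it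
        -- would be a hit. So for i < B both ρ + i and ρ + i + 1 stay strictly between 0 and q, as
        -- `ω-class` requires.
        below : ∀ l → l ℕ.< suc B → ρ ℕ.+ l ℕ.< q
        below zero    _  = subst (ℕ._< q) (sym (ℕ.+-identityʳ ρ)) ρ<q
        below (suc l) l< = ℕ.≤∧≢⇒< (subst (ℕ._≤ q) (sym (ℕ.+-suc ρ l)) (below l (ℕ.<⇒≤ l<)))
          (λ e → miss (suc l , l< , ℕ.∣-reflexive (sym e)))
        W-fine : ∀ {i} → i ℕ.< B → FineSeries (λ a → W (cls q ρ a + + i))
        W-fine {i} i<B j s = mul (con (-1ℤ ^ j))
          (ext (λ a → cong (λ k → ω k j) (cls-+ a))
            (ω-class p-prime m′ (ρ ℕ.+ i) j (ℕ.<-≤-trans 0<ρ (ℕ.m≤m+n ρ i))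
              (subst (ℕ._< q) (ℕ.+-suc ρ i) (below (suc i) (s<s i<B))) s))
          where
          open Closed (fine-closed p-prime s)
          cls-+ : ∀ a → cls q (ρ ℕ.+ i) a ≡ cls q ρ a + + i
          cls-+ a = trans (cong (_+_ (+ q * a)) (pos-+ ρ i)) (sym (+-assoc (+ q * a) (+ ρ) (+ i)))

    summand-tame : ∀ d → Tame B (summand d)
    summand-tame d = record
      { vanish = λ q k l l< q∣ → let (factored f weight≡ _) = weight-factor l l< in
          ∣m⇒∣m*n (coeffs k d) (subst (+ q ∣_) (sym (weight≡ k)) (∣m⇒∣m*n (f k) q∣))
      ; fine   = λ {p} p-prime m′ ρ (l , l< , q∣) miss ρ< → fine′ p-prime m′ ρ l l< q∣ miss ρ<
      ; odd    = λ k → trans (cong₂ _*_ (weight-odd k) (coeffs-even k d)) (sym (neg-distribˡ-* (weight k) (coeffs k d)))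
      }
      where
      fine′ : ∀ {p} (p-prime : Prime p) m′ ρ l → l ℕ.< suc B → p ℕ.^ m′ ℕ.∣ ρ ℕ.+ l →
              ¬ Hits B (p ℕ.^ suc m′) ρ → ρ ℕ.< p ℕ.^ suc m′ →
              ∃[ f ] (∀ a → summand d (cls (p ℕ.^ suc m′) ρ a) ≡ + (p ℕ.^ m′) * f a) × FINE p-prime f
      fine′ {p} p-prime m′ ρ l l< (ℕ.divides e ρ+l≡) miss ρ< with weight-factor l l<
      ... | factored f weight≡ F =
        -- On this class k + l = p^m′ (p a + e): this one factor of the weight yields p^m′, and what
        -- remains of it is affine with slope p, hence fine.
        (λ a → (+ p * a + + e) * f (k a) * coeffs (k a) d) ,
        (λ a → trans (cong (_* coeffs (k a) d) (trans (weight≡ (k a)) (cong (_* f (k a)) (k+l a))))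
                 (l₁ (+ q) (+ p * a + + e) (f (k a)) (coeffs (k a) d))) ,
        (λ s → let open Closed (fine-closed p-prime s) in
          mul (mul (affine-fine p-prime s (+ e)) (on-class F p-prime m′ ρ s)) (coeffs-fine p-prime (suc m′) ρ ρ< miss d s))
        where
        q = p ℕ.^ m′
        k : ℤ → ℤ
        k = cls (p ℕ.^ suc m′) ρ
        l₁ : ∀ q x y z → q * x * y * z ≡ q * (x * y * z)
        l₁ = solve-∀
        k+l : ∀ a → k a + + l ≡ + q * (+ p * a + + e)
        k+l a = begin
          + (p ℕ.* q) * a + + ρ + + l      ≡⟨ +-assoc (+ (p ℕ.* q) * a) (+ ρ) (+ l) ⟩
          + (p ℕ.* q) * a + (+ ρ + + l)    ≡⟨ cong₂ (λ x y → x * a + y) (pos-* p q)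
                                                (trans (sym (pos-+ ρ l)) (trans (cong +_ ρ+l≡) (pos-* e q))) ⟩
          + p * + q * a + + e * + q        ≡⟨ l₂ (+ p) (+ q) a (+ e) ⟩
          + q * (+ p * a + + e)            ∎
          where
          open ≡-Reasoning
          l₂ : ∀ p q a e → p * q * a + e * q ≡ q * (p * a + e)
          l₂ = solve-∀

-- Transfer to polynomials with rational coefficients, and the least common multiple.

module Integrality where

  import Algebra.Definitions.RawSemiring as RawSemiringDefinitions
  open import Data.Integer.Base as ℤ using (ℤ; +_; -[1+_]; 0ℤ; 1ℤ; -1ℤ)
  open import Data.Integer.Divisibility.Signed using () renaming (_∣_ to _∣ℤ_)
  import Data.Integer.Divisibility.Signed as ℤ∣
  import Data.Integer.Properties as ℤ
  import Data.Integer.Tactic.RingSolver as ℤ-Solver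
  open import Data.List.Base using (List; []; _∷_; applyUpTo)
  open import Data.List.Relation.Unary.All using (All; []; _∷_)
  open import Data.Nat.Base as ℕ using (ℕ; zero; suc; s<s)
  open import Data.Nat.Combinatorics using (_C_; k>n⇒nCk≡0)
  import Data.Nat.Divisibility as ℕ
  open import Data.Nat.LCM using (lcm-least)
  import Data.Nat.Properties as ℕ
  open import Data.Product.Base using (_,_)
  open import Data.Rational.Base using (0ℚ; 1ℚ; _+_; _*_; _/_; ↥_; +-*-rawSemiring)
  open import Data.Rational.Literals using (fromℤ)
  open import Data.Rational.Properties
    using (↥p/↧p≡p; fromℚᵘ-cong; toℚᵘ-injective; toℚᵘ-homo-*; toℚᵘ-fromℚᵘ; *-zeroʳ; +-identityʳ; +-identityˡ)
  import Data.Rational.Unnormalised.Base as ℚᵘ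
  import Data.Rational.Unnormalised.Properties as ℚᵘ
  open import Relation.Binary.PropositionalEquality
  open import Relation.Nullary using (yes; no)
  open Binomials
  open Descent using (tame-∣)
  open Reflections using (∑; ν)
  open Series using (Series; tail; one; _⊛_; ⊛-cong; zero-⊛; ∏)
  open Summand using (W; weight; base; power; coeffs; summand; summand-tame; pair; Π; Π-cong; Π-snoc; Π-rev; Π-*)

  open Polynomial +-*-rawSemiring using (coeff; _⊕_; _⊗_)
  private module ℚ-Ops = RawSemiringDefinitions +-*-rawSemiring

  /1≡fromℤ : ∀ z → z / 1 ≡ fromℤ z
  /1≡fromℤ z = ↥p/↧p≡p (fromℤ z)

  fromℤ-+ : ∀ x y → fromℤ (x ℤ.+ y) ≡ fromℤ x + fromℤ y
  fromℤ-+ x y = trans (sym (/1≡fromℤ (x ℤ.+ y)))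
    (cong (_/ 1) (sym (cong₂ ℤ._+_ (ℤ.*-identityʳ x) (ℤ.*-identityʳ y))))

  fromℤ-* : ∀ x y → fromℤ (x ℤ.* y) ≡ fromℤ x * fromℤ y
  fromℤ-* x y = sym (/1≡fromℤ (x ℤ.* y))

  fromℤ-^ : ∀ x n → fromℤ (x ℤ.^ n) ≡ fromℤ x ℚ-Ops.^ n
  fromℤ-^ x zero    = refl
  fromℤ-^ x (suc n) = trans (fromℤ-* x (x ℤ.^ n)) (cong (fromℤ x *_) (fromℤ-^ x n))

  /-exact : ∀ x d z → x ≡ + suc d ℤ.* z → x / suc d ≡ fromℤ z
  /-exact x d z x≡ = trans
    (fromℚᵘ-cong {ℚᵘ.mkℚᵘ x d} {ℚᵘ.mkℚᵘ z 0} (ℚᵘ.*≡* (trans (ℤ.*-identityʳ x) (trans x≡ (ℤ.*-comm (+ suc d) z)))))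
    (/1≡fromℤ z)

  scaled-integer : ∀ c L .{{_ : ℕ.NonZero L}} x z → c ℤ.* x ≡ z ℤ.* + L → (c / L) * fromℤ x ≡ fromℤ z
  scaled-integer c L@(suc d) x z eq = toℚᵘ-injective (ℚᵘ.≃-trans (toℚᵘ-homo-* (c / L) (fromℤ x))
    (ℚᵘ.≃-trans (ℚᵘ.*-congʳ (toℚᵘ-fromℚᵘ (ℚᵘ.mkℚᵘ c d)))
      (ℚᵘ.*≡* (trans (ℤ.*-identityʳ (c ℤ.* x)) (trans eq (cong (λ n → z ℤ.* + n) (sym (ℕ.*-identityʳ L))))))))

  infix 4 _represents_

  record _represents_ (p : ℚ[x]) (A : Series) : Set where
    constructor coefficients
    field
      coeff≡ : ∀ i → coeff p i ≡ fromℤ (A i)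

  open _represents_

  coeff-⊕ : ∀ p q i → coeff (p ⊕ q) i ≡ coeff p i + coeff q i
  coeff-⊕ []      q       i       = sym (+-identityˡ (coeff q i))
  coeff-⊕ (a ∷ p) []      i       = sym (+-identityʳ (coeff (a ∷ p) i))
  coeff-⊕ (a ∷ p) (b ∷ q) zero    = refl
  coeff-⊕ (a ∷ p) (b ∷ q) (suc i) = coeff-⊕ p q i

  coeff-· : ∀ c p i → coeff (c · p) i ≡ c * coeff p i
  coeff-· c []      i       = sym (*-zeroʳ c)
  coeff-· c (a ∷ p) zero    = refl
  coeff-· c (a ∷ p) (suc i) = coeff-· c p i

  represents-cong : ∀ {p A B} → (∀ i → A i ≡ B i) → p represents A → p represents B
  represents-cong A≡B P = coefficients λ i → trans (coeff≡ P i) (cong fromℤ (A≡B i))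

  represents-⊕ : ∀ {p q A B} → p represents A → q represents B → p ⊕ q represents (λ i → A i ℤ.+ B i)
  represents-⊕ {p} {q} {A} {B} P Q = coefficients λ i →
    trans (coeff-⊕ p q i) (trans (cong₂ _+_ (coeff≡ P i) (coeff≡ Q i)) (sym (fromℤ-+ (A i) (B i))))

  represents-· : ∀ z {p A} → p represents A → fromℤ z · p represents (λ i → z ℤ.* A i)
  represents-· z {p} {A} P = coefficients λ i →
    trans (coeff-· (fromℤ z) p i) (trans (cong (fromℤ z *_) (coeff≡ P i)) (sym (fromℤ-* z (A i))))

  represents-⊗ : ∀ {p q A B} → p represents A → q represents B → p ⊗ q represents A ⊛ B
  represents-⊗ {[]} {q} {A} {B} P Q = coefficients λ i →
    -- Taking numerators undoes `fromℤ`, so a series represented by the empty list is zero.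
    cong fromℤ (sym (trans (⊛-cong {A} {λ _ → 0ℤ} {B} (λ j → cong ↥_ (sym (coeff≡ P j))) (λ _ → refl) i) (zero-⊛ B i)))
  represents-⊗ {a ∷ p} {q} {A} {B} P Q = coefficients go
    where
    open ≡-Reasoning
    head : ∀ i → coeff (a · q) i ≡ fromℤ (A 0 ℤ.* B i)
    head i = trans (coeff-· a q i) (trans (cong₂ _*_ (coeff≡ P 0) (coeff≡ Q i)) (sym (fromℤ-* (A 0) (B i))))
    go : ∀ i → coeff ((a · q) ⊕ (0ℚ ∷ (p ⊗ q))) i ≡ fromℤ ((A ⊛ B) i)
    go zero    = trans (coeff-⊕ (a · q) _ 0) (trans (+-identityʳ _) (head 0))
    go (suc i) = trans (coeff-⊕ (a · q) _ (suc i)) (trans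
      (cong₂ _+_ (head (suc i)) (coeff≡ (represents-⊗ {p} {q} {tail A} (coefficients λ j → coeff≡ P (suc j)) Q) i))
      (sym (fromℤ-+ (A 0 ℤ.* B (suc i)) ((tail A ⊛ B) i))))

  represents-one : 1ℚ ∷ [] represents one
  represents-one = coefficients λ { zero → refl ; (suc i) → refl }

  represents-^ : ∀ m {p A} → p represents A → p ^ᵖ m represents ∏ m (λ _ → A)
  represents-^ zero    P = represents-one
  represents-^ (suc m) P = represents-⊗ P (represents-^ m P)

  represents-∏ : ∀ n {f : ℕ → ℚ[x]} {F : ℕ → Series} → (∀ i → f i represents F i) → ∏[0⋯< n ] f represents ∏ n F
  represents-∏ zero    P = represents-one
  represents-∏ (suc n) {f} {F} P =
    represents-⊗ (P 0) (represents-∏ n {λ i → f (suc i)} {λ i → F (suc i)} (λ i → P (suc i)))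

  represents-∑ : ∀ n {f : ℕ → ℚ[x]} {F : ℕ → Series} → (∀ k → f (suc k) represents F k) →
                 ∑[1⋯ n ] f represents (λ d → ∑ n (λ k → F k d))
  represents-∑ zero    P = coefficients λ _ → refl
  represents-∑ (suc n) {f} {F} P =
    represents-⊕ {A = F 0} {B = λ d → ∑ n (λ k → F (suc k) d)} (P 0)
      (represents-∑ n {λ k → f (suc k)} {λ k → F (suc k)} (λ k → P (suc k)))

  coeff-applyUpTo : ∀ f k i → i ℕ.< k → coeff (applyUpTo f k) i ≡ f i
  coeff-applyUpTo f (suc k) zero    _         = refl
  coeff-applyUpTo f (suc k) (suc i) (s<s i<k) = coeff-applyUpTo (λ i → f (suc i)) k i i<k

  coeff-applyUpTo-≥ : ∀ f k i → k ℕ.≤ i → coeff (applyUpTo f k) i ≡ 0ℚ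
  coeff-applyUpTo-≥ f zero    i       _            = refl
  coeff-applyUpTo-≥ f (suc k) (suc i) (ℕ.s≤s k≤i) = coeff-applyUpTo-≥ (λ i → f (suc i)) k i k≤i

  [-1]^n*[-1]^n : ∀ n → -1ℤ ℤ.^ n ℤ.* -1ℤ ℤ.^ n ≡ 1ℤ
  [-1]^n*[-1]^n zero    = refl
  [-1]^n*[-1]^n (suc n) = trans (l (-1ℤ ℤ.^ n)) ([-1]^n*[-1]^n n)
    where
    l : ∀ x → -1ℤ ℤ.* x ℤ.* (-1ℤ ℤ.* x) ≡ x ℤ.* x
    l = ℤ-Solver.solve-∀

  suc-W : ∀ k i → + ((k C i) ℕ.* ((suc k ℕ.+ suc i) C i)) ≡ + suc i ℤ.* W (+ suc k) i
  suc-W k i = sym (begin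
    + suc i ℤ.* (s ℤ.* ω (+ suc k) i)
      ≡⟨ l₁ (+ suc i) s (ω (+ suc k) i) ⟩
    s ℤ.* (+ suc i ℤ.* ω (+ suc k) i)
      ≡⟨ cong (s ℤ.*_) (suc-ω (+ suc k) i) ⟩
    s ℤ.* (+ (k C i) ℤ.* ((ν (+ suc k) ℤ.- 1ℤ) choose i))
      ≡⟨ cong (λ n → s ℤ.* (+ (k C i) ℤ.* (-[1+ suc n ] choose i))) (ℕ.+-identityʳ (suc k)) ⟩
    s ℤ.* (+ (k C i) ℤ.* (s ℤ.* + ((suc (suc k) ℕ.+ i) C i)))
      ≡⟨ l₂ s (+ (k C i)) (+ ((suc (suc k) ℕ.+ i) C i)) ⟩
    s ℤ.* s ℤ.* (+ (k C i) ℤ.* + ((suc (suc k) ℕ.+ i) C i))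
      ≡⟨ cong₂ ℤ._*_ ([-1]^n*[-1]^n i) (cong (λ n → + (k C i) ℤ.* + (n C i)) (sym (ℕ.+-suc (suc k) i))) ⟩
    1ℤ ℤ.* (+ (k C i) ℤ.* + ((suc k ℕ.+ suc i) C i))
      ≡⟨ trans (ℤ.*-identityˡ _) (sym (ℤ.pos-* (k C i) _)) ⟩
    + ((k C i) ℕ.* ((suc k ℕ.+ suc i) C i)) ∎)
    where
    open ≡-Reasoning
    s = -1ℤ ℤ.^ i
    l₁ : ∀ a s w → a ℤ.* (s ℤ.* w) ≡ s ℤ.* (a ℤ.* w)
    l₁ = ℤ-Solver.solve-∀
    l₂ : ∀ s a b → s ℤ.* (a ℤ.* (s ℤ.* b)) ≡ s ℤ.* s ℤ.* (a ℤ.* b)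
    l₂ = ℤ-Solver.solve-∀

  w≡W : ∀ k i → w (suc k) (suc i) ≡ fromℤ (W (+ suc k) i)
  w≡W k i = /-exact _ i (W (+ suc k) i) (suc-W k i)

  -- The factor C(k, i) in `suc-W` is zero. This reconciles the finite list `wPoly` with an infinite
  -- series.
  W-vanishes : ∀ k i → suc k ℕ.≤ i → W (+ suc k) i ≡ 0ℤ
  W-vanishes k i k<i = ℤ.*-cancelˡ-≡ (+ suc i) _ _ (trans (sym (suc-W k i))
    (trans (cong (λ c → + (c ℕ.* ((suc k ℕ.+ suc i) C i))) (k>n⇒nCk≡0 k<i)) (sym (ℤ.*-zeroʳ (+ suc i)))))

  -- The positive exponent matters beyond the degree, where 0 to the power 0 would produce spurious
  -- coefficients 1.
  wPoly-represents : ∀ α β m r k → wPoly (suc α) (suc k) represents base β (suc α) m r (+ suc k)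
  wPoly-represents α β m r k = coefficients go
    where
    go : ∀ i → coeff (wPoly (suc α) (suc k)) i ≡ fromℤ (W (+ suc k) i ℤ.^ suc α)
    go i with i ℕ.<? suc k
    ... | yes i<k = trans (coeff-applyUpTo (λ i → w (suc k) (suc i) ℚ-Ops.^ suc α) (suc k) i i<k)
      (trans (cong (ℚ-Ops._^ suc α) (w≡W k i)) (sym (fromℤ-^ (W (+ suc k) i) (suc α))))
    ... | no  i≮k = trans (coeff-applyUpTo-≥ (λ i → w (suc k) (suc i) ℚ-Ops.^ suc α) (suc k) i (ℕ.≮⇒≥ i≮k))
      (cong fromℤ (sym (trans (cong (ℤ._^ suc α) (W-vanishes k i (ℕ.≮⇒≥ i≮k))) (ℤ.*-zeroˡ (0ℤ ℤ.^ α)))))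

  rising-Π : ∀ y N → + rising y N ≡ Π N (λ l → + (y ℕ.+ l))
  rising-Π y zero    = refl
  rising-Π y (suc N) = trans (ℤ.pos-* (rising y N) (y ℕ.+ N))
    (trans (cong (ℤ._* + (y ℕ.+ N)) (rising-Π y N)) (sym (Π-snoc N (λ l → + (y ℕ.+ l)))))

  pos-^ : ∀ x n → + (x ℕ.^ n) ≡ (+ x) ℤ.^ n
  pos-^ x zero    = refl
  pos-^ x (suc n) = trans (ℤ.pos-* x (x ℕ.^ n)) (cong (+ x ℤ.*_) (pos-^ x n))

  ^-distribʳ-* : ∀ n x y → (x ℕ.* y) ℕ.^ n ≡ x ℕ.^ n ℕ.* y ℕ.^ n
  ^-distribʳ-* zero    x y = refl
  ^-distribʳ-* (suc n) x y = trans (cong (x ℕ.* y ℕ.*_) (^-distribʳ-* n x y))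
    (ℕ.[m*n]*[o*p]≡[m*o]*[n*p] x y (x ℕ.^ n) (y ℕ.^ n))

  Π-pair : ∀ α β m r k → Π β (pair β α m r (+ k)) ≡ + (rising k β ℕ.* rising (k ℕ.+ β ℕ.+ 1) β)
  Π-pair α β m r k = begin
    Π β (λ l → + (k ℕ.+ l) ℤ.* + (k ℕ.+ (2 ℕ.* β ℕ.∸ l)))
      ≡⟨ Π-* β (λ l → + (k ℕ.+ l)) (λ l → + (k ℕ.+ (2 ℕ.* β ℕ.∸ l))) ⟩
    Π β (λ l → + (k ℕ.+ l)) ℤ.* Π β (λ l → + (k ℕ.+ (2 ℕ.* β ℕ.∸ l)))
      -- The second factors k + 2β - l run through (k+β+1)_β from its top factor downwards, hence
      -- the reversal.
      ≡⟨ cong₂ ℤ._*_ (sym (rising-Π k β)) (trans (Π-cong β (λ l<β → cong +_ (index l<β)))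
           (trans (sym (Π-rev β (λ l → + (k ℕ.+ β ℕ.+ 1 ℕ.+ l)))) (sym (rising-Π (k ℕ.+ β ℕ.+ 1) β)))) ⟩
    + rising k β ℤ.* + rising (k ℕ.+ β ℕ.+ 1) β
      ≡⟨ ℤ.pos-* (rising k β) _ ⟨
    + (rising k β ℕ.* rising (k ℕ.+ β ℕ.+ 1) β) ∎
    where
    open ≡-Reasoning
    index : ∀ {l} → l ℕ.< β → k ℕ.+ (2 ℕ.* β ℕ.∸ l) ≡ k ℕ.+ β ℕ.+ 1 ℕ.+ (β ℕ.∸ suc l)
    index {l} l<β = begin
      k ℕ.+ (2 ℕ.* β ℕ.∸ l)                  ≡⟨ cong (λ b → k ℕ.+ (b ℕ.∸ l)) (cong (β ℕ.+_) (ℕ.+-identityʳ β)) ⟩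
      k ℕ.+ (β ℕ.+ β ℕ.∸ l)                  ≡⟨ cong (k ℕ.+_) (ℕ.+-∸-assoc β (ℕ.<⇒≤ l<β)) ⟩
      k ℕ.+ (β ℕ.+ (β ℕ.∸ l))                ≡⟨ ℕ.+-assoc k β _ ⟨
      k ℕ.+ β ℕ.+ (β ℕ.∸ l)                  ≡⟨ cong (k ℕ.+ β ℕ.+_) (ℕ.+-∸-assoc 1 l<β) ⟩
      k ℕ.+ β ℕ.+ (1 ℕ.+ (β ℕ.∸ suc l))      ≡⟨ ℕ.+-assoc (k ℕ.+ β) 1 _ ⟨
      k ℕ.+ β ℕ.+ 1 ℕ.+ (β ℕ.∸ suc l)        ∎

  weight≡ : ∀ α β m r k →
    + (rising k β ℕ.^ suc r ℕ.* rising (k ℕ.+ β ℕ.+ 1) β ℕ.^ suc r ℕ.* (k ℕ.+ β)) ≡ weight β α m r (+ k)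
  weight≡ α β m r k = begin
    + (R ℕ.^ suc r ℕ.* R′ ℕ.^ suc r ℕ.* (k ℕ.+ β))
      ≡⟨ ℤ.pos-* (R ℕ.^ suc r ℕ.* R′ ℕ.^ suc r) (k ℕ.+ β) ⟩
    + (R ℕ.^ suc r ℕ.* R′ ℕ.^ suc r) ℤ.* + (k ℕ.+ β)
      ≡⟨ cong (λ x → + x ℤ.* + (k ℕ.+ β)) (^-distribʳ-* (suc r) R R′) ⟨
    + ((R ℕ.* R′) ℕ.^ suc r) ℤ.* + (k ℕ.+ β)
      ≡⟨ cong (ℤ._* + (k ℕ.+ β)) (trans (pos-^ (R ℕ.* R′) (suc r)) (cong (ℤ._^ suc r) (sym (Π-pair α β m r k)))) ⟩
    weight β α m r (+ k) ∎
    where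
    open ≡-Reasoning
    R = rising k β
    R′ = rising (k ℕ.+ β ℕ.+ 1) β

  lcmRange-least : ∀ n l {x} → (∀ e → e ℕ.≤ l → n ℕ.+ e ℕ.∣ x) → lcmRange n l ℕ.∣ x
  lcmRange-least n zero    h = subst (ℕ._∣ _) (ℕ.+-identityʳ n) (h 0 ℕ.z≤n)
  lcmRange-least n (suc l) h =
    lcm-least (lcmRange-least n l (λ e e≤l → h e (ℕ.m≤n⇒m≤1+n e≤l))) (h (suc l) ℕ.≤-refl)

  scaled-integral : ∀ c L .{{_ : ℕ.NonZero L}} {p A} → p represents A → (∀ d → + L ∣ℤ c ℤ.* A d) →
                    ((c / L) · p) ∈ℤ[x]
  scaled-integral c L {[]}        P L∣ = []
  scaled-integral c L {a ∷ p} {A} P L∣ =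
    (z , trans (cong ((c / L) *_) (coeff≡ P 0)) (scaled-integer c L (A 0) z eq)) ∷
    scaled-integral c L {p} {tail A} (coefficients λ i → coeff≡ P (suc i)) (λ d → L∣ (suc d))
    where
    z = ℤ∣.quotient (L∣ 0)
    eq : c ℤ.* A 0 ≡ z ℤ.* + L
    eq = ℤ∣._∣_.equality (L∣ 0)

  term : (α β m r k : ℕ) → ℚ[x]
  term α β m r k =
    fromℕ (rising k β ℕ.^ r ℕ.* rising (k ℕ.+ β ℕ.+ 1) β ℕ.^ r ℕ.* (k ℕ.+ β)) ·
      ∏[0⋯< 2 ℕ.* β ] (λ i → wPoly α (k ℕ.+ i) ^ᵖ m)

  term-represents : ∀ α β m r k →
    term (suc α) β m (suc r) (suc k) represents (λ d → summand β (suc α) m r d (+ suc k))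
  term-represents α β m r k = represents-cong
    (λ d → cong (ℤ._* coeffs β (suc α) m r (+ suc k) d) (weight≡ (suc α) β m r (suc k)))
    (represents-· (+ (rising (suc k) β ℕ.^ suc r ℕ.* rising (suc k ℕ.+ β ℕ.+ 1) β ℕ.^ suc r ℕ.* (suc k ℕ.+ β)))
      (represents-∏ (2 ℕ.* β) {λ i → wPoly (suc α) (suc k ℕ.+ i) ^ᵖ m}
        {λ i → power β (suc α) m r (+ suc k ℤ.+ + i)}
        (λ i → represents-^ m (wPoly-represents α β m r (k ℕ.+ i)))))

  integrality : ∀ α β m n r → .{{_ : ℕ.NonZero β}} → .{{_ : ℕ.NonZero n}} →
    ((+ 2 / lcmRange n (2 ℕ.* β ℕ.+ 1)) {{lcmRange≢0 n (2 ℕ.* β ℕ.+ 1)}} ·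
      ∑[1⋯ n ] (term (suc α) β m (suc r))) ∈ℤ[x]
  integrality α β m n r =
    scaled-integral (+ 2) (lcmRange n (2 ℕ.* β ℕ.+ 1)) {{lcmRange≢0 n (2 ℕ.* β ℕ.+ 1)}} {A = S}
      (represents-∑ n {term (suc α) β m (suc r)} {λ k d → summand β (suc α) m r d (+ suc k)}
        (term-represents α β m r))
      -- The offsets e ≤ 2β + 1 in the least common multiple are exactly those with e ≤ B + 1
      -- allowed by `tame-∣`.
      (λ d → ℤ∣.∣ᵤ⇒∣ {i = + 2 ℤ.* S d} (lcmRange-least n (2 ℕ.* β ℕ.+ 1) (λ e e≤ →
        ℤ∣.∣⇒∣ᵤ {i = + 2 ℤ.* S d} (tame-∣ {G = summand β (suc α) m r d} (summand-tame β (suc α) m r d) 0<B n e (subst (e ℕ.≤_) (ℕ.+-comm (2 ℕ.* β) 1) e≤)))))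
    where
    S : Series
    S d = ∑ n (λ k → summand β (suc α) m r d (+ suc k))
    0<B : 0 ℕ.< 2 ℕ.* β
    0<B = ℕ.>-nonZero⁻¹ (2 ℕ.* β) {{ℕ.m*n≢0 2 β}}

open import Data.Empty using (⊥-elim)
open import Data.Integer.Base using (+_)
open import Data.Nat.Base using (ℕ; zero; suc; _+_; _*_; _^_; NonZero; ≢-nonZero⁻¹)
open import Data.Rational.Base using (_/_)
open import Relation.Binary.PropositionalEquality using (refl)

theorem6 : (α β m n r : ℕ) → .{{_ : NonZero α}} → .{{_ : NonZero β}} → .{{_ : NonZero m}} → .{{_ : NonZero n}} → .{{_ : NonZero r}} →
    ((+ 2 / lcmRange n (2 * β + 1)) {{lcmRange≢0 n (2 * β + 1)}} ·
    ∑[1⋯ n ] (λ k →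
    fromℕ (rising k β ^ r * rising (k + β + 1) β ^ r * (k + β)) ·
    ∏[0⋯< 2 * β ] (λ i → wPoly α (k + i) ^ᵖ m)))
    ∈ℤ[x]
theorem6 zero    β m n r       = ⊥-elim (≢-nonZero⁻¹ 0 refl)
theorem6 (suc α) β m n zero    = ⊥-elim (≢-nonZero⁻¹ 0 refl)
theorem6 (suc α) β m n (suc r) = Integrality.integrality α β m n r
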